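{- Let $2\le k\leq r\leq n$ and $\mathcal{E}(r)=\{g_0=\emptyset,g_1,\ldots,g_m\}$. Define $f=(f_0,\ldots,f_m)^T$ by $$f_i=\begin{cases}(-1)^{|g_i|}\binom{n-cv(g_i)}{k-cv(g_i)} & \text{if } cv(g_i)\leq k \text{ and } |g_i|\neq\binom{k}{2},\text{ or } cv(g_i)<k,\\[2pt] 1+(-1)^{|g_i|}\binom{n-cv(g_i)}{k-cv(g_i)} & \text{if } cv(g_i)=k\text{ and }|g_i|=\binom{k}{2},\\[2pt] 0&\text{if } cv(g_i)>k.\end{cases}$$ Suppose that the minimum of $f^Tz$ over all integer vectors $z=(z_0,\ldots,z_m)^T\geq0$ with $z_0=1$ subject to the constraints $$\text{(I)}\quad -(E^{ -1})^TDz\leq0,$$ $$\text{(II)}\quad z_iz_j-\sum_{l}c_{ij}^lz_l=0\quad\text{for all } i,j\text{ with } cv(g_i)+cv(g_j)\leq r,$$ is strictly positive, where $E$ is the $E$-transform of $\mathcal{E}(r)$ and $$D=\mathrm{diag}\left(\binom nr,\binom{n-cv(g_1)}{r-cv(g_1)},\ldots,\binom{n-cv(g_m)}{r-cv(g_m)}\right).$$ Then $r(k)\leq n$. In particular the minimal such $n\ge r$ (if it exists) is an upper bound for the Ramsey number $r(k)$.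
   Context: Graphs are finite and simple. The Ramsey number $r(k)$ is the minimum number $n$ such that every simple graph with $n$ vertices contains a clique of order $k$ or an independent set of order $k$. $\mathcal{E}(r)$ is the set of isomorphism classes of simple graphs with $r$ vertices. $I(g)(h)$ is the number of (not necessarily induced) subgraphs of $h$ isomorphic to $g$, isolated vertices being disregarded, with $I(\emptyset)=1$ for the edgeless graph $\emptyset$. $|g|$ is the number of edges of $g$ and $cv(g)$ the number of non-isolated vertices of $g$. The $E$-transform of $\mathcal{E}(r)$ is the (invertible) matrix $E=(e_{ij})$, $e_{ij}=I(g_j)(g_i)$, $0\le i,j\le m$. The coefficients in (II) are $c_{ij}^l=\sum_{h=0}^m(-1)^{|g_l|-|g_h|}e_{lh}e_{hi}e_{hj}$. Inequalities between vectors are componentwise. -}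

module Defs where

open import Data.Bool using (Bool; true; false; if_then_else_)
import Data.Bool.Properties as Bool
open import Data.Fin using (Fin; zero; suc)
open import Data.Fin.Permutation using (Permutation; permutation; _⟨$⟩ʳ_; _⟨$⟩ˡ_; inverseˡ; inverseʳ)
import Data.Fin.Properties as Fin
open import Data.Fin.Subset using (Subset; inside; outside; ∣_∣; _∈_)
open import Data.Integer as ℤ using (ℤ; +_; 0ℤ; 1ℤ; -1ℤ)
import Data.Integer.Properties as ℤ
open import Data.List as List using (List; []; _∷_; length; filter; cartesianProductWith; allFin)
open import Data.Nat as ℕ using (ℕ; zero; suc; _+_; _∸_; _≤_; _<_; _≤?_; _<?_; _≟_; ∣_-_∣)
open import Data.Nat.Combinatorics using (_C_)
open import Data.Product using (∃; ∃-syntax; Σ-syntax; _×_; _,_)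
open import Data.Sum using (_⊎_)
open import Data.Vec as Vec using (Vec; []; _∷_; lookup; tabulate)
open import Data.Vec.Functional using (Vector)
open import Data.Vec.Properties using (lookup∘tabulate)
open import Relation.Binary.PropositionalEquality using (_≡_; _≢_; sym; trans; cong; cong₂)
open import Relation.Nullary using (Dec; does)
open import Relation.Nullary.Decidable using (map′; _×-dec_; _⊎-dec_; _→-dec_; ¬?)

open import Algebra.Properties.Semiring.Sum ℤ.+-*-semiring using (sum-syntax)

private
  variable
    a b m n r : ℕ

IsLeast : {A : Set} → (A → A → Set) → (A → Set) → A → Set
IsLeast _⊑_ P x = P x × (∀ y → P y → x ⊑ y)

-- A simple graph on the vertex set Fin n, stored as the strict triangle of its
-- adjacency matrix: g ▸ N adds to g a new vertex, numbered zero, whose set of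
-- neighbours among the vertices of g is N.  Every labelled simple graph has
-- exactly one such description.
infixl 5 _▸_
data Graph : ℕ → Set where
  ∅   : Graph 0
  _▸_ : Graph n → Subset n → Graph (suc n)

adj : Graph n → Fin n → Fin n → Bool
adj (g ▸ N) zero    zero    = false
adj (g ▸ N) zero    (suc v) = lookup N v
adj (g ▸ N) (suc u) zero    = lookup N u
adj (g ▸ N) (suc u) (suc v) = adj g u v

Adj : Graph n → Fin n → Fin n → Set
Adj g u v = adj g u v ≡ true

size : Graph n → ℕ
size ∅       = 0
size (g ▸ N) = size g + ∣ N ∣

IsClique : Graph n → Subset n → Set
IsClique g S = ∀ u v → u ∈ S → v ∈ S → u ≢ v → adj g u v ≡ true

IsIndependent : Graph n → Subset n → Set
IsIndependent g S = ∀ u v → u ∈ S → v ∈ S → u ≢ v → adj g u v ≡ false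

RamseyProperty : ℕ → ℕ → Set
RamseyProperty k n = (g : Graph n) →
    (∃[ S ] ∣ S ∣ ≡ k × IsClique g S)
  ⊎ (∃[ S ] ∣ S ∣ ≡ k × IsIndependent g S)

IsRamseyNumber : ℕ → ℕ → Set
IsRamseyNumber k = IsLeast _≤_ (RamseyProperty k)

_≅_ : Graph a → Graph b → Set
_≅_ {a} {b} g h =
  Σ[ π ∈ Permutation a b ] (∀ u v → adj g u v ≡ adj h (π ⟨$⟩ʳ u) (π ⟨$⟩ʳ v))

anyVec? : ∀ n {P : Vec (Fin b) n → Set} → (∀ xs → Dec (P xs)) → Dec (∃ P)
anyVec? zero    P? = map′ ([] ,_) (λ { ([] , p) → p }) (P? [])
anyVec? (suc n) P? =
  map′ (λ { (x , xs , p) → x ∷ xs , p }) (λ { (x ∷ xs , p) → x , xs , p })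
       (Fin.any? λ x → anyVec? n λ xs → P? (x ∷ xs))

_≅?_ : (g : Graph a) (h : Graph b) → Dec (g ≅ h)
_≅?_ {a} {b} g h = map′ fromVecs toVecs search
  where
  IsIso : Vec (Fin b) a → Vec (Fin a) b → Set
  IsIso φ ψ = (∀ v → lookup φ (lookup ψ v) ≡ v)
            × (∀ u → lookup ψ (lookup φ u) ≡ u)
            × (∀ u v → adj g u v ≡ adj h (lookup φ u) (lookup φ v))

  search : Dec (∃[ φ ] ∃[ ψ ] IsIso φ ψ)
  search = anyVec? a λ φ → anyVec? b λ ψ →
          Fin.all? (λ v → lookup φ (lookup ψ v) Fin.≟ v)
    ×-dec Fin.all? (λ u → lookup ψ (lookup φ u) Fin.≟ u)
    ×-dec Fin.all? (λ u → Fin.all? λ v → adj g u v Bool.≟ adj h (lookup φ u) (lookup φ v))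

  fromVecs : (∃[ φ ] ∃[ ψ ] IsIso φ ψ) → g ≅ h
  fromVecs (φ , ψ , φψ , ψφ , e) = permutation (lookup φ) (lookup ψ) φψ ψφ , e

  toVecs : g ≅ h → ∃[ φ ] ∃[ ψ ] IsIso φ ψ
  toVecs (π , e) = φ , ψ
    , (λ v → trans (φ≗ (lookup ψ v)) (trans (cong (π ⟨$⟩ʳ_) (ψ≗ v)) (inverseʳ π)))
    , (λ u → trans (ψ≗ (lookup φ u)) (trans (cong (π ⟨$⟩ˡ_) (φ≗ u)) (inverseˡ π)))
    , (λ u v → trans (e u v) (cong₂ (adj h) (sym (φ≗ u)) (sym (φ≗ v))))
    where
    φ : Vec (Fin b) a
    φ = tabulate (π ⟨$⟩ʳ_)
    ψ : Vec (Fin a) b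
    ψ = tabulate (π ⟨$⟩ˡ_)
    φ≗ : ∀ u → lookup φ u ≡ π ⟨$⟩ʳ u
    φ≗ = lookup∘tabulate (π ⟨$⟩ʳ_)
    ψ≗ : ∀ v → lookup ψ v ≡ π ⟨$⟩ˡ v
    ψ≗ = lookup∘tabulate (π ⟨$⟩ˡ_)

NonIsolated : Graph n → Fin n → Set
NonIsolated g v = ∃[ u ] Adj g v u

nonIsolated : Graph n → List (Fin n)
nonIsolated {n} g = filter (λ v → Fin.any? λ u → adj g v u Bool.≟ true) (allFin n)

cv : Graph n → ℕ
cv g = length (nonIsolated g)

-- The vertices of induced g vs are the positions in vs; for duplicate-free vs
-- this is the induced subgraph of g on vs.
induced : Graph n → (vs : List (Fin n)) → Graph (length vs)
induced g []       = ∅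
induced g (v ∷ vs) = induced g vs ▸ tabulate (λ i → adj g v (List.lookup vs i))

core : (g : Graph n) → Graph (cv g)
core g = induced g (nonIsolated g)

allSubsets : ∀ n → List (Subset n)
allSubsets zero    = [] ∷ []
allSubsets (suc n) = cartesianProductWith _∷_ (outside ∷ inside ∷ []) (allSubsets n)

allGraphs : ∀ n → List (Graph n)
allGraphs zero    = ∅ ∷ []
allGraphs (suc n) = cartesianProductWith _▸_ (allGraphs n) (allSubsets n)

_⊆_ : Graph n → Graph n → Set
g ⊆ h = ∀ u v → Adj g u v → Adj h u v

_⊆?_ : (g h : Graph n) → Dec (g ⊆ h)
g ⊆? h = Fin.all? λ u → Fin.all? λ v →
  (adj g u v Bool.≟ true) →-dec (adj h u v Bool.≟ true)

-- With isolated vertices disregarded, a subgraph of h is determined by its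
-- edges, so the spanning subgraphs of h list every subgraph exactly once.
I : Graph a → Graph b → ℕ
I {b = b} g h = length (filter (λ s → (s ⊆? h) ×-dec (core s ≅? core g)) (allGraphs b))

-- A system of representatives g₀ = ∅, g₁, …, gₘ of the isomorphism classes of
-- graphs with r vertices.
record Representatives (r m : ℕ) : Set where
  field
    g        : Fin (suc m) → Graph r
    edgeless : size (g zero) ≡ 0
    distinct : ∀ i j → g i ≅ g j → i ≡ j
    complete : (h : Graph r) → ∃[ i ] h ≅ g i

Matrix : ℕ → Set
Matrix n = Fin n → Fin n → ℤ

infixl 7 _·_ _·ᵥ_
infix  8 _ᵀ

_·_ : Matrix n → Matrix n → Matrix n
_·_ {n} A B i j = ∑[ h < n ] (A i h ℤ.* B h j)

_·ᵥ_ : Matrix n → Vector ℤ n → Vector ℤ n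
_·ᵥ_ {n} A x i = ∑[ h < n ] (A i h ℤ.* x h)

_ᵀ : Matrix n → Matrix n
(A ᵀ) i j = A j i

-ₘ_ : Matrix n → Matrix n
(-ₘ A) i j = ℤ.- A i j

diag : Vector ℤ n → Matrix n
diag d i j = if does (i Fin.≟ j) then d i else 0ℤ

𝟙 : Matrix n
𝟙 = diag (λ _ → 1ℤ)

IsInverse : Matrix n → Matrix n → Set
IsInverse A B = (∀ i j → (A · B) i j ≡ 𝟙 i j) × (∀ i j → (B · A) i j ≡ 𝟙 i j)

-- (-1)^(a - b); the exponent may be negative, but (-1)^(-d) = (-1)^d.
sign : ℕ → ℕ → ℤ
sign a b = -1ℤ ℤ.^ ∣ a - b ∣

module _ (𝓔 : Representatives r m) where
  open Representatives 𝓔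

  E : Matrix (suc m)
  E i j = + I (g j) (g i)

  c : (i j l : Fin (suc m)) → ℤ
  c i j l = ∑[ h < suc m ] (sign (size (g l)) (size (g h)) ℤ.* E l h ℤ.* E h i ℤ.* E h j)

  module _ (n : ℕ) where

    D : Matrix (suc m)
    D = diag (λ i → + ((n ∸ cv (g i)) C (r ∸ cv (g i))))

    f : ℕ → Vector ℤ (suc m)
    f k i =
      if does (((cv (g i) ≤? k) ×-dec ¬? (size (g i) ≟ k C 2)) ⊎-dec (cv (g i) <? k))
        then term
      else if does ((cv (g i) ≟ k) ×-dec (size (g i) ≟ k C 2))
        then 1ℤ ℤ.+ term
      else 0ℤ
      where
      term : ℤ
      term = -1ℤ ℤ.^ size (g i) ℤ.* + ((n ∸ cv (g i)) C (k ∸ cv (g i)))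

    objective : ℕ → Vector ℤ (suc m) → ℤ
    objective k z = ∑[ i < suc m ] (f k i ℤ.* z i)

    module _ (E⁻¹ : Matrix (suc m)) where

      record Feasible (z : Vector ℤ (suc m)) : Set where
        field
          nonnegative : ∀ i → 0ℤ ℤ.≤ z i
          normalised  : z zero ≡ 1ℤ
          constraintI : ∀ i → ((-ₘ (E⁻¹ ᵀ) · D) ·ᵥ z) i ℤ.≤ 0ℤ
          constraintII : ∀ i j → cv (g i) + cv (g j) ≤ r →
            z i ℤ.* z j ℤ.- ∑[ l < suc m ] (c i j l ℤ.* z l) ≡ 0ℤ

      IsMinimum : ℕ → ℤ → Set
      IsMinimum k = IsLeast ℤ._≤_ (λ v → ∃[ z ] Feasible z × v ≡ objective k z)

      MinimumPositive : ℕ → Set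
      MinimumPositive k = ∃[ μ ] IsMinimum k μ × 0ℤ ℤ.< μ

{-# OPTIONS --safe #-}
module Submission where

-- Suppose that a graph G with n vertices has no k-clique and no independent k-set,
-- and put z i = I(gᵢ)(G).  Counting, for each r-subset S of the vertices, the class of
-- the induced graph G[S] gives D z = Eᵀ x with x ≥ 0, which is (I).  The product
-- z i * z j counts pairs of subgraphs; grouping the pairs by their union and computing
-- the number of pairs with a given union by Möbius inversion over the subgraph order
-- gives (II).  Finally Σ (-1)^|s| over the subgraphs s of G[S] is 1 if G[S] is
-- edgeless and 0 otherwise, so fᵀ z counts the k-cliques and the independent k-sets
-- and vanishes: the minimum is not positive.

open import Defs
open import Data.Nat using (ℕ; suc; _≤_)
open import Data.Product using (∃-syntax; _×_)

open import Data.Bool using (Bool; true; false; _∧_; _∨_; if_then_else_; b≤b; f≤t)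
  renaming (_≤_ to _≤ᵇ_)
import Data.Bool.Properties as Bool
open import Data.Fin using (Fin; zero; suc; inject≤)
open import Data.Fin.Permutation as Perm
  using (permutation; _⟨$⟩ʳ_; _⟨$⟩ˡ_; inverseˡ; inverseʳ)
import Data.Fin.Properties as Fin
open import Data.Fin.Subset as Subset using (Subset; inside; outside; ∣_∣)
import Data.Fin.Subset.Properties as Subset
open import Data.Integer as ℤ using (ℤ; 0ℤ; 1ℤ; -1ℤ; _+_; _*_; _^_; -_; _-_) renaming (+_ to pos)
import Data.Integer.Properties as ℤ
open import Data.Integer.Tactic.RingSolver using (solve-∀)
open import Data.List as List
  using (List; []; _∷_; _++_; length; filter; map; cartesianProductWith; allFin)
open import Data.List.Membership.Propositional using () renaming (_∈_ to _∈ₗ_)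
open import Data.List.Membership.Propositional.Properties
  using (∈-∃++; ∈-++⁺ˡ; ∈-++⁺ʳ; ∈-++⁻; ∈-cartesianProductWith⁺; ∈-filter⁺; ∈-filter⁻; ∈-lookup; ∈-allFin; ∈-map⁻)
open import Data.List.Properties using (length-++; length-map)
open import Data.List.Relation.Unary.All as All using (All; []; _∷_)
open import Data.List.Relation.Unary.AllPairs using ([]; _∷_)
open import Data.List.Relation.Unary.Any as Any using (here; there)
open import Data.List.Relation.Unary.Any.Properties using (lookup-index)
open import Data.List.Relation.Unary.Unique.Propositional using (Unique)
import Data.List.Relation.Unary.Unique.Propositional.Properties as Unique
import Data.Nat as ℕ
open import Data.Nat.Combinatorics using (_C_; nC1≡n; nCk+nC[k+1]≡[n+1]C[k+1])
import Data.Nat.Properties as ℕ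
open import Data.Nat.Tactic.RingSolver using () renaming (solve-∀ to ℕ-solve-∀)
open import Data.Product using (_,_; proj₁; proj₂)
open import Data.Sum as Sum using (_⊎_; inj₁; inj₂; [_,_]′)
open import Data.Unit using (⊤)
open import Data.Vec as Vec using ([]; _∷_; lookup; here; there)
open import Data.Vec.Properties
  using (lookup∘tabulate; tabulate∘lookup; tabulate-cong; lookup-replicate; []=⇒lookup; lookup⇒[]=)
open import Function using (_∘_; id)
open import Relation.Binary.PropositionalEquality
  using (_≡_; _≢_; refl; sym; trans; cong; cong₂; subst; subst₂; module ≡-Reasoning)
open import Relation.Nullary using (Dec; yes; no; does; ¬_; contradiction; _×-dec_)
open import Relation.Nullary.Decidable
  using (dec-true; dec-false; map′; decidable-stable; toSum; _→-dec_; _⊎-dec_; ¬?)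

open import Algebra.Properties.Semiring.Sum ℤ.+-*-semiring using (sum-syntax)

open ≡-Reasoning

private
  variable
    X Y Z P Q : Set
    a b l m n r : ℕ

-- Indicators and sums over lists

-- The classes are represented by graphs with `r` vertices, whereas the counted subgraphs live on
-- `n` vertices. Graphs of different orders therefore have to be compared up to isolated vertices;
-- this is the relation `≈`, and `cv`, `size` and `I` are shown to be invariant under it. A sum over
-- subgraphs can be rewritten as a sum over classes only if every contributing subgraph has at most
-- `r` non-isolated vertices. In (II) the condition on `cv (g i) + cv (g j)` ensures this for unions
-- of pairs; in the objective it follows from `k ≤ r`. The extra 1 in `f` sits on the class with `k`
-- non-isolated vertices and `k C 2` edges, the complete graph on `k` vertices, so its contribution
-- is the number of k-cliques. The remaining terms count independent k-sets: the binomial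
-- coefficient is the number of k-sets around a given subgraph, and the signs cancel unless the
-- k-set spans no edge. All cancellation comes from one fact: an interval of subgraphs has the rank
-- generating function of a Boolean lattice.

⟦_⟧ : Dec P → ℤ
⟦ yes _ ⟧ = 1ℤ
⟦ no  _ ⟧ = 0ℤ

⟦⟧-yes : (p : Dec P) → P → ⟦ p ⟧ ≡ 1ℤ
⟦⟧-yes (yes _) _ = refl
⟦⟧-yes (no ¬x) x = contradiction x ¬x

⟦⟧-no : (p : Dec P) → ¬ P → ⟦ p ⟧ ≡ 0ℤ
⟦⟧-no (yes x) ¬x = contradiction x ¬x
⟦⟧-no (no _)  _  = refl

⟦⟧-cong : (p : Dec P) (q : Dec Q) → (P → Q) → (Q → P) → ⟦ p ⟧ ≡ ⟦ q ⟧
⟦⟧-cong (yes x) q f g = sym (⟦⟧-yes q (f x))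
⟦⟧-cong (no ¬x) q f g = sym (⟦⟧-no q (¬x ∘ g))

⟦⟧-× : (p : Dec P) (q : Dec Q) → ⟦ p ×-dec q ⟧ ≡ ⟦ p ⟧ * ⟦ q ⟧
⟦⟧-× (yes _) (yes _) = refl
⟦⟧-× (yes _) (no _)  = refl
⟦⟧-× (no _)  (yes _) = refl
⟦⟧-× (no _)  (no _)  = refl

⟦⟧-*-cong : (p : Dec P) {x y : ℤ} → (P → x ≡ y) → ⟦ p ⟧ * x ≡ ⟦ p ⟧ * y
⟦⟧-*-cong (yes a) e = cong (1ℤ *_) (e a)
⟦⟧-*-cong (no _)  e = refl

⟦⟧-*-zero : (p : Dec P) {x : ℤ} → (P → x ≡ 0ℤ) → ⟦ p ⟧ * x ≡ 0ℤ
⟦⟧-*-zero p e = trans (⟦⟧-*-cong p e) (ℤ.*-zeroʳ ⟦ p ⟧)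

⟦⟧-nonneg : (p : Dec P) → 0ℤ ℤ.≤ ⟦ p ⟧
⟦⟧-nonneg (yes _) = ℤ.+≤+ ℕ.z≤n
⟦⟧-nonneg (no _)  = ℤ.≤-refl

Σ : List X → (X → ℤ) → ℤ
Σ []       f = 0ℤ
Σ (x ∷ xs) f = f x + Σ xs f

syntax Σ xs (λ x → e) = Σ[ x ← xs ] e

Σ-cong : (xs : List X) {f g : X → ℤ} → (∀ x → f x ≡ g x) → Σ xs f ≡ Σ xs g
Σ-cong []       e = refl
Σ-cong (x ∷ xs) e = cong₂ _+_ (e x) (Σ-cong xs e)

Σ-zero : {xs : List X} {f : X → ℤ} → All (λ x → f x ≡ 0ℤ) xs → Σ xs f ≡ 0ℤ
Σ-zero []       = refl
Σ-zero (e ∷ es) = cong₂ _+_ e (Σ-zero es)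

Σ-zero′ : (xs : List X) {f : X → ℤ} → (∀ x → f x ≡ 0ℤ) → Σ xs f ≡ 0ℤ
Σ-zero′ xs e = Σ-zero {xs = xs} (All.universal e xs)

Σ-distrib-+ : (xs : List X) (f g : X → ℤ) → Σ[ x ← xs ] (f x + g x) ≡ Σ xs f + Σ xs g
Σ-distrib-+ []       f g = refl
Σ-distrib-+ (x ∷ xs) f g = trans (cong (f x + g x +_) (Σ-distrib-+ xs f g)) (interchange (f x) (g x) _ _)
  where
  interchange : ∀ a b c d → a + b + (c + d) ≡ a + c + (b + d)
  interchange = solve-∀

*-distribˡ-Σ : (xs : List X) (a : ℤ) (f : X → ℤ) → a * Σ xs f ≡ Σ[ x ← xs ] (a * f x)
*-distribˡ-Σ []       a f = ℤ.*-zeroʳ a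
*-distribˡ-Σ (x ∷ xs) a f = trans (ℤ.*-distribˡ-+ a (f x) _) (cong (a * f x +_) (*-distribˡ-Σ xs a f))

*-distribʳ-Σ : (xs : List X) (a : ℤ) (f : X → ℤ) → Σ xs f * a ≡ Σ[ x ← xs ] (f x * a)
*-distribʳ-Σ xs a f =
  trans (ℤ.*-comm _ a) (trans (*-distribˡ-Σ xs a f) (Σ-cong xs λ x → ℤ.*-comm a (f x)))

Σ-comm : (xs : List X) (ys : List Y) (f : X → Y → ℤ) →
         Σ[ x ← xs ] Σ[ y ← ys ] f x y ≡ Σ[ y ← ys ] Σ[ x ← xs ] f x y
Σ-comm []       ys f = sym (Σ-zero′ ys λ _ → refl)
Σ-comm (x ∷ xs) ys f =
  trans (cong (Σ ys (f x) +_) (Σ-comm xs ys f)) (sym (Σ-distrib-+ ys (f x) (λ y → Σ xs (λ x → f x y))))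

Σ-*-Σ : (xs : List X) (ys : List Y) (f : X → ℤ) (g : Y → ℤ) →
        Σ xs f * Σ ys g ≡ Σ[ x ← xs ] Σ[ y ← ys ] (f x * g y)
Σ-*-Σ xs ys f g =
  trans (*-distribʳ-Σ xs (Σ ys g) f) (Σ-cong xs λ x → *-distribˡ-Σ ys (f x) g)

Σ-++ : (xs ys : List X) (f : X → ℤ) → Σ (xs ++ ys) f ≡ Σ xs f + Σ ys f
Σ-++ []       ys f = sym (ℤ.+-identityˡ _)
Σ-++ (x ∷ xs) ys f = trans (cong (f x +_) (Σ-++ xs ys f)) (sym (ℤ.+-assoc (f x) _ _))

Σ-map : (h : X → Y) (xs : List X) (f : Y → ℤ) → Σ (map h xs) f ≡ Σ xs (f ∘ h)
Σ-map h []       f = refl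
Σ-map h (x ∷ xs) f = cong (f (h x) +_) (Σ-map h xs f)

Σ-cartesianProductWith : (_∙_ : X → Y → Z) (xs : List X) (ys : List Y) (f : Z → ℤ) →
  Σ (cartesianProductWith _∙_ xs ys) f ≡ Σ[ x ← xs ] Σ[ y ← ys ] f (x ∙ y)
Σ-cartesianProductWith _∙_ []       ys f = refl
Σ-cartesianProductWith _∙_ (x ∷ xs) ys f = trans
  (Σ-++ (map (x ∙_) ys) _ f)
  (cong₂ _+_ (Σ-map (x ∙_) ys f) (Σ-cartesianProductWith _∙_ xs ys f))

Σ-single : {xs : List X} {f : X → ℤ} {x : X} → Unique xs → x ∈ₗ xs →
           (∀ y → y ≢ x → f y ≡ 0ℤ) → Σ xs f ≡ f x
Σ-single {f = f} (x∉ ∷ _) (here refl) e = trans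
  (cong (f _ +_) (Σ-zero (All.map (λ x≢y → e _ (x≢y ∘ sym)) x∉)))
  (ℤ.+-identityʳ (f _))
Σ-single {f = f} (y∉ ∷ u) (there x∈) e = trans
  (cong₂ _+_ (e _ (All.lookup y∉ x∈)) (Σ-single u x∈ e))
  (ℤ.+-identityˡ (f _))

Σ-nonneg : (xs : List X) {f : X → ℤ} → (∀ x → 0ℤ ℤ.≤ f x) → 0ℤ ℤ.≤ Σ xs f
Σ-nonneg []       e = ℤ.≤-refl
Σ-nonneg (x ∷ xs) e = ℤ.+-mono-≤ (e x) (Σ-nonneg xs e)

length-filter : {P : X → Set} (P? : ∀ x → Dec (P x)) (xs : List X) →
                pos (length (filter P? xs)) ≡ Σ[ x ← xs ] ⟦ P? x ⟧
length-filter P? []       = refl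
length-filter P? (x ∷ xs) with P? x
... | yes _ = cong (1ℤ +_) (length-filter P? xs)
... | no  _ = trans (length-filter P? xs) (sym (ℤ.+-identityˡ _))

-- The matrix products and the objective are sums over `Fin`; as list sums they can be interchanged
-- with sums over graphs and over vertex sets.
∑≡Σ : ∀ n (f : Fin n → ℤ) → ∑[ i < n ] f i ≡ Σ[ i ← allFin n ] f i
∑≡Σ n f = go n id
  where
  go : ∀ k (h : Fin k → Fin n) → ∑[ i < k ] f (h i) ≡ Σ (List.tabulate h) f
  go 0       h = refl
  go (suc k) h = cong (f (h zero) +_) (go k (h ∘ suc))

-- Graphs and their adjacency functions

true⇔⇒≡ : {x y : Bool} → (x ≡ true → y ≡ true) → (y ≡ true → x ≡ true) → x ≡ y
true⇔⇒≡ {true}          f g = sym (f refl)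
true⇔⇒≡ {false} {true}  f g = g refl
true⇔⇒≡ {false} {false} f g = refl

does⇒ : (p : Dec P) → does p ≡ true → P
does⇒ (yes x) _ = x

lookup-ext : (N M : Subset n) → (∀ v → lookup N v ≡ lookup M v) → N ≡ M
lookup-ext N M e = trans (sym (tabulate∘lookup N)) (trans (tabulate-cong e) (tabulate∘lookup M))

adj-irrefl : (g : Graph n) → ∀ v → adj g v v ≡ false
adj-irrefl (g ▸ N) zero    = refl
adj-irrefl (g ▸ N) (suc v) = adj-irrefl g v

adj-sym : (g : Graph n) → ∀ u v → adj g u v ≡ adj g v u
adj-sym (g ▸ N) zero    zero    = refl
adj-sym (g ▸ N) zero    (suc v) = refl
adj-sym (g ▸ N) (suc u) zero    = refl
adj-sym (g ▸ N) (suc u) (suc v) = adj-sym g u v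

Adj-sym : (g : Graph n) → ∀ {u v} → Adj g u v → Adj g v u
Adj-sym g {u} {v} e = trans (adj-sym g v u) e

Adj⇒nonIsolatedʳ : (g : Graph n) → ∀ {u v} → Adj g u v → NonIsolated g v
Adj⇒nonIsolatedʳ g e = _ , Adj-sym g e

adj-ext : (g h : Graph n) → (∀ u v → adj g u v ≡ adj h u v) → g ≡ h
adj-ext ∅       ∅       e = refl
adj-ext (g ▸ N) (h ▸ M) e =
  cong₂ _▸_ (adj-ext g h λ u v → e (suc u) (suc v)) (lookup-ext N M λ v → e zero (suc v))

⊆-refl : (g : Graph n) → g ⊆ g
⊆-refl g u v = id

⊆-trans : {g h k : Graph n} → g ⊆ h → h ⊆ k → g ⊆ k
⊆-trans p q u v = q u v ∘ p u v

⊆-antisym : {g h : Graph n} → g ⊆ h → h ⊆ g → g ≡ h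
⊆-antisym {g = g} {h} p q = adj-ext g h λ u v → true⇔⇒≡ (p u v) (q u v)

-- Only the entries above the diagonal are read, which is why `adj-fromAdj` asks for a symmetric and
-- irreflexive `A`.
fromAdj : (Fin n → Fin n → Bool) → Graph n
fromAdj {ℕ.zero} A = ∅
fromAdj {suc n}  A = fromAdj (λ u v → A (suc u) (suc v)) ▸ Vec.tabulate (λ v → A zero (suc v))

adj-fromAdj : (A : Fin n → Fin n → Bool) →
              (∀ v → A v v ≡ false) → (∀ u v → A u v ≡ A v u) →
              ∀ u v → adj (fromAdj A) u v ≡ A u v
adj-fromAdj A irr sy zero    zero    = sym (irr zero)
adj-fromAdj A irr sy zero    (suc v) = lookup∘tabulate _ v
adj-fromAdj A irr sy (suc u) zero    = trans (lookup∘tabulate _ u) (sy zero (suc u))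
adj-fromAdj A irr sy (suc u) (suc v) =
  adj-fromAdj _ (irr ∘ suc) (λ u v → sy (suc u) (suc v)) u v

allSubsets-complete : (S : Subset n) → S ∈ₗ allSubsets n
allSubsets-complete []            = here refl
allSubsets-complete (outside ∷ S) = ∈-cartesianProductWith⁺ _∷_ {xs = outside ∷ inside ∷ []} (here refl) (allSubsets-complete S)
allSubsets-complete (inside  ∷ S) = ∈-cartesianProductWith⁺ _∷_ {xs = outside ∷ inside ∷ []} (there (here refl)) (allSubsets-complete S)

allSubsets-unique : ∀ n → Unique (allSubsets n)
allSubsets-unique ℕ.zero  = [] ∷ []
allSubsets-unique (suc n) = Unique.cartesianProductWith⁺ _∷_ (λ { refl → refl , refl })
  (((λ ()) ∷ []) ∷ [] ∷ []) (allSubsets-unique n)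

allGraphs-complete : (g : Graph n) → g ∈ₗ allGraphs n
allGraphs-complete ∅       = here refl
allGraphs-complete (g ▸ N) = ∈-cartesianProductWith⁺ _▸_ (allGraphs-complete g) (allSubsets-complete N)

allGraphs-unique : ∀ n → Unique (allGraphs n)
allGraphs-unique ℕ.zero  = [] ∷ []
allGraphs-unique (suc n) = Unique.cartesianProductWith⁺ _▸_ (λ { refl → refl , refl })
  (allGraphs-unique n) (allSubsets-unique n)

Σ-graph : {f : Graph n → ℤ} (g : Graph n) → (∀ h → h ≢ g → f h ≡ 0ℤ) →
          Σ (allGraphs n) f ≡ f g
Σ-graph {n = n} g = Σ-single (allGraphs-unique n) (allGraphs-complete g)

unique-length-≤ : {xs ys : List X} → Unique xs → (∀ {x} → x ∈ₗ xs → x ∈ₗ ys) → length xs ≤ length ys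
unique-length-≤ [] _ = ℕ.z≤n
unique-length-≤ {xs = x ∷ xs} {ys} (x∉ ∷ u) incl
  with as , bs , refl ← ∈-∃++ (incl (here refl)) =
  subst (suc (length xs) ≤_) (sym lengths) (ℕ.s≤s (unique-length-≤ u incl′))
  where
  lengths : length (as ++ x ∷ bs) ≡ suc (length (as ++ bs))
  lengths = trans (length-++ as) (trans (ℕ.+-suc _ _) (cong suc (sym (length-++ as))))
  incl′ : ∀ {y} → y ∈ₗ xs → y ∈ₗ as ++ bs
  incl′ y∈ with ∈-++⁻ as (incl (there y∈))
  ... | inj₁ y∈as         = ∈-++⁺ˡ y∈as
  ... | inj₂ (here refl)  = contradiction refl (All.lookup x∉ y∈)
  ... | inj₂ (there y∈bs) = ∈-++⁺ʳ as y∈bs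

map-unique : (f : X → Y) (xs : List X) → (∀ {x y} → x ∈ₗ xs → y ∈ₗ xs → f x ≡ f y → x ≡ y) →
             Unique xs → Unique (map f xs)
map-unique f []       inj []       = []
map-unique f (x ∷ xs) inj (x∉ ∷ u) =
  All.tabulate (λ z∈ → λ { refl → distinct z∈ }) ∷ map-unique f xs (λ p q → inj (there p) (there q)) u
  where
  distinct : ¬ f x ∈ₗ map f xs
  distinct z∈ with y , y∈ , e ← ∈-map⁻ f z∈ = All.lookup x∉ y∈ (inj (here refl) (there y∈) e)

-- The form in which counts are compared: an injection between the counted objects that need only be
-- injective on those satisfying `P`.
filter-length-≤ : {P : X → Set} {Q : Y → Set} (P? : ∀ x → Dec (P x)) (Q? : ∀ y → Dec (Q y))
                  {xs : List X} {ys : List Y} (f : X → Y) →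
                  (∀ {x} → P x → Q (f x)) → (∀ {x y} → P x → P y → f x ≡ f y → x ≡ y) →
                  Unique xs → (∀ y → y ∈ₗ ys) →
                  length (filter P? xs) ≤ length (filter Q? ys)
filter-length-≤ P? Q? {xs} {ys} f PQ inj u all = subst (_≤ _) (length-map f (filter P? xs))
  (unique-length-≤
    (map-unique f _ (λ p q → inj (holds p) (holds q)) (Unique.filter⁺ P? u))
    λ z∈ → image z∈)
  where
  holds : ∀ {x} → x ∈ₗ filter P? xs → _
  holds x∈ = proj₂ (∈-filter⁻ P? {xs = xs} x∈)
  image : ∀ {z} → z ∈ₗ map f (filter P? xs) → z ∈ₗ filter Q? ys
  image z∈ with x , x∈ , refl ← ∈-map⁻ f z∈ = ∈-filter⁺ Q? (all _) (PQ (holds x∈))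

-- Isomorphism up to isolated vertices

≅-sym : {g : Graph a} {h : Graph b} → g ≅ h → h ≅ g
≅-sym {h = h} (π , e) = Perm.flip π , λ u v →
  trans (sym (cong₂ (adj h) (inverseʳ π) (inverseʳ π))) (sym (e (π ⟨$⟩ˡ u) (π ⟨$⟩ˡ v)))

≅-trans : {g : Graph a} {h : Graph b} {k : Graph l} → g ≅ h → h ≅ k → g ≅ k
≅-trans (π , d) (ρ , e) = π Perm.∘ₚ ρ , λ u v → trans (d u v) (e (π ⟨$⟩ʳ u) (π ⟨$⟩ʳ v))

-- A record rather than a synonym, so that the two graphs can be inferred.
infix 4 _≈_
record _≈_ (g : Graph a) (h : Graph b) : Set where
  constructor mk≈
  field core≅ : core g ≅ core h

_≈?_ : (g : Graph a) (h : Graph b) → Dec (g ≈ h)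
g ≈? h = map′ mk≈ _≈_.core≅ (core g ≅? core h)

≈-sym : {g : Graph a} {h : Graph b} → g ≈ h → h ≈ g
≈-sym {g = g} {h} (mk≈ p) = mk≈ (≅-sym {g = core g} {core h} p)

≈-trans : {g : Graph a} {h : Graph b} {k : Graph l} → g ≈ h → h ≈ k → g ≈ k
≈-trans {g = g} {h} {k} (mk≈ p) (mk≈ q) = mk≈ (≅-trans {g = core g} {core h} {core k} p q)

≈-cv : {g : Graph a} {h : Graph b} → g ≈ h → cv g ≡ cv h
≈-cv (mk≈ (π , _)) = Perm.↔⇒≡ π

nonIsolated? : (g : Graph n) (v : Fin n) → Dec (NonIsolated g v)
nonIsolated? g v = Fin.any? λ u → adj g v u Bool.≟ true

ι : (g : Graph n) → Fin (cv g) → Fin n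
ι g = List.lookup (nonIsolated g)

lookup-injective : {xs : List X} → Unique xs → ∀ i j → List.lookup xs i ≡ List.lookup xs j → i ≡ j
lookup-injective (x∉ ∷ u) zero    zero    e = refl
lookup-injective (x∉ ∷ u) zero    (suc j) e = contradiction e (All.lookup x∉ (∈-lookup j))
lookup-injective (x∉ ∷ u) (suc i) zero    e = contradiction (sym e) (All.lookup x∉ (∈-lookup i))
lookup-injective (x∉ ∷ u) (suc i) (suc j) e = cong suc (lookup-injective u i j e)

ι-injective : (g : Graph n) → ∀ {i j} → ι g i ≡ ι g j → i ≡ j
ι-injective {n} g = lookup-injective (Unique.filter⁺ (nonIsolated? g) (Unique.allFin⁺ n)) _ _

ι-nonIsolated : (g : Graph n) → ∀ i → NonIsolated g (ι g i)
ι-nonIsolated {n} g i = proj₂ (∈-filter⁻ (nonIsolated? g) {xs = allFin n} (∈-lookup {xs = nonIsolated g} i))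

ι-covers : (g : Graph n) → ∀ {v} → NonIsolated g v → ∃[ i ] ι g i ≡ v
ι-covers g {v} nv = Any.index v∈ , sym (lookup-index v∈)
  where
  v∈ : v ∈ₗ nonIsolated g
  v∈ = ∈-filter⁺ (nonIsolated? g) (∈-allFin v) nv

adj-induced : (g : Graph n) (vs : List (Fin n)) → ∀ i j →
              adj (induced g vs) i j ≡ adj g (List.lookup vs i) (List.lookup vs j)
adj-induced g (v ∷ vs) zero    zero    = sym (adj-irrefl g v)
adj-induced g (v ∷ vs) zero    (suc j) = lookup∘tabulate _ j
adj-induced g (v ∷ vs) (suc i) zero    = trans (lookup∘tabulate _ i) (adj-sym g v (List.lookup vs i))
adj-induced g (v ∷ vs) (suc i) (suc j) = adj-induced g vs i j

adj-core : (g : Graph n) → ∀ i j → adj (core g) i j ≡ adj g (ι g i) (ι g j)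
adj-core g = adj-induced g (nonIsolated g)

-- An isomorphism between induced subgraphs that contain all non-isolated vertices but possibly
-- isolated ones too. This freedom lets isomorphisms, the inclusion of a core, transported graphs
-- and the empty matching of two edgeless graphs all be instances, with no computation on the lists
-- of non-isolated vertices.
record Correspondence (g : Graph a) (h : Graph b) : Set where
  field
    p           : ℕ
    α           : Fin p → Fin a
    β           : Fin p → Fin b
    α-injective : ∀ {i j} → α i ≡ α j → i ≡ j
    β-injective : ∀ {i j} → β i ≡ β j → i ≡ j
    adj-αβ      : ∀ i j → adj g (α i) (α j) ≡ adj h (β i) (β j)
    α-covers    : ∀ {v} → NonIsolated g v → ∃[ i ] α i ≡ v
    β-covers    : ∀ {v} → NonIsolated h v → ∃[ i ] β i ≡ v

flip : {g : Graph a} {h : Graph b} → Correspondence g h → Correspondence h g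
flip K = record
  { α = β ; β = α ; α-injective = β-injective ; β-injective = α-injective
  ; adj-αβ = λ i j → sym (adj-αβ i j) ; α-covers = β-covers ; β-covers = α-covers }
  where open Correspondence K

≈⇒correspondence : {g : Graph a} {h : Graph b} → g ≈ h → Correspondence g h
≈⇒correspondence {g = g} {h} (mk≈ (π , e)) = record
  { α = ι g
  ; β = λ i → ι h (π ⟨$⟩ʳ i)
  ; α-injective = ι-injective g
  ; β-injective = λ q → trans (sym (inverseˡ π)) (trans (cong (π ⟨$⟩ˡ_) (ι-injective h q)) (inverseˡ π))
  ; adj-αβ = λ i j → trans (sym (adj-core g i j)) (trans (e i j) (adj-core h _ _))
  ; α-covers = ι-covers g
  ; β-covers = λ nv → let (j , q) = ι-covers h nv in π ⟨$⟩ˡ j , trans (cong (ι h) (inverseʳ π)) q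
  }

module _ {g : Graph a} {h : Graph b} (K : Correspondence g h) where
  open Correspondence K

  nonIsolated-αβ : ∀ {i} → NonIsolated g (α i) → NonIsolated h (β i)
  -- The neighbour `u` is itself non-isolated, hence some `α j`, so the edge can be carried over to
  -- `h`.
  nonIsolated-αβ {i} (u , e) with j , refl ← α-covers (Adj⇒nonIsolatedʳ g e) =
    β j , trans (sym (adj-αβ i j)) e

  image : ∀ i → ∃[ j ] ∃[ q ] α q ≡ ι g i × β q ≡ ι h j
  image i =
    let (q , e) = α-covers (ι-nonIsolated g i)
        (j , d) = ι-covers h (nonIsolated-αβ (subst (NonIsolated g) (sym e) (ι-nonIsolated g i)))
    in j , q , e , sym d

correspondence⇒≈ : {g : Graph a} {h : Graph b} → Correspondence g h → g ≈ h
correspondence⇒≈ {g = g} {h} K = mk≈ (permutation to from to-from from-to , preserves)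
  where
  open Correspondence K
  to : Fin (cv g) → Fin (cv h)
  to = proj₁ ∘ image K
  from : Fin (cv h) → Fin (cv g)
  from = proj₁ ∘ image (flip K)
  -- `to` and `from` choose their indices in `Fin p` independently. Injectivity of `α` shows that
  -- the two choices agree, so the round trip returns to the start.
  matched : ∀ {i q j j′ q′} → α q ≡ ι g i → β q ≡ ι h j → β q′ ≡ ι h j′ → α q′ ≡ ι g i → j′ ≡ j
  matched αq βq βq′ αq′ =
    ι-injective h (trans (sym βq′) (trans (cong β (α-injective (trans αq′ (sym αq)))) βq))
  matched′ : ∀ {j q i i′ q′} → β q ≡ ι h j → α q ≡ ι g i → α q′ ≡ ι g i′ → β q′ ≡ ι h j → i′ ≡ i
  matched′ βq αq αq′ βq′ =
    ι-injective g (trans (sym αq′) (trans (cong α (β-injective (trans βq′ (sym βq)))) αq))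
  to-from : ∀ j → to (from j) ≡ j
  to-from j =
    let (i , _ , βq , αq) = image (flip K) j
        (_ , _ , αq′ , βq′) = image K i
    in matched αq βq βq′ αq′
  from-to : ∀ i → from (to i) ≡ i
  from-to i =
    let (j , _ , αq , βq) = image K i
        (_ , _ , βq′ , αq′) = image (flip K) j
    in matched′ βq αq αq′ βq′
  preserves : ∀ u v → adj (core g) u v ≡ adj (core h) (to u) (to v)
  preserves u v =
    let (j , q , αq , βq) = image K u
        (j′ , q′ , αq′ , βq′) = image K v
    in trans (adj-core g u v) (trans (sym (cong₂ (adj g) αq αq′))
        (trans (adj-αβ q q′) (trans (cong₂ (adj h) βq βq′) (sym (adj-core h j j′)))))

≅⇒≈ : {g : Graph a} {h : Graph b} → g ≅ h → g ≈ h
≅⇒≈ (π , e) = correspondence⇒≈ record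
  { α = id ; β = π ⟨$⟩ʳ_ ; α-injective = id
  ; β-injective = λ q → trans (sym (inverseˡ π)) (trans (cong (π ⟨$⟩ˡ_) q) (inverseˡ π))
  ; adj-αβ = e ; α-covers = λ _ → _ , refl
  ; β-covers = λ _ → _ , inverseʳ π }

core-≈ : (g : Graph a) → core g ≈ g
core-≈ g = correspondence⇒≈ record
  { α = id ; β = ι g ; α-injective = id ; β-injective = ι-injective g
  ; adj-αβ = adj-core g ; α-covers = λ _ → _ , refl ; β-covers = ι-covers g }

-- Transport of subgraphs along a partial injection

module Transport {p : ℕ} (α : Fin p → Fin a) (β : Fin p → Fin b)
                 (α-injective : ∀ {i j} → α i ≡ α j → i ≡ j)
                 (β-injective : ∀ {i j} → β i ≡ β j → i ≡ j) where

  Image : Graph a → Fin b → Fin b → Set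
  Image s x y = ∃[ i ] ∃[ j ] β i ≡ x × β j ≡ y × Adj s (α i) (α j)

  image? : ∀ s x y → Dec (Image s x y)
  image? s x y = Fin.any? λ i → Fin.any? λ j →
    (β i Fin.≟ x) ×-dec (β j Fin.≟ y) ×-dec (adj s (α i) (α j) Bool.≟ true)

  -- The image under the partial injection sending `α i` to `β i`. Edges with an end outside the
  -- range of `α` are lost; `Covers` excludes this.
  transport : Graph a → Graph b
  transport s = fromAdj λ x y → does (image? s x y)

  Image-sym : ∀ s {x y} → Image s x y → Image s y x
  Image-sym s (i , j , p , q , e) = j , i , q , p , Adj-sym s e

  Image-irrefl : ∀ s {x} → ¬ Image s x x
  Image-irrefl s (i , j , p , q , e) with refl ← β-injective (trans p (sym q)) =
    contradiction (trans (sym e) (adj-irrefl s (α i))) λ ()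

  adj-transport : ∀ s x y → adj (transport s) x y ≡ does (image? s x y)
  adj-transport s = adj-fromAdj _
    (λ x → dec-false (image? s x x) (Image-irrefl s))
    (λ x y → true⇔⇒≡ (λ e → dec-true (image? s y x) (Image-sym s (does⇒ (image? s x y) e)))
                     (λ e → dec-true (image? s x y) (Image-sym s (does⇒ (image? s y x) e))))

  Adj⇒Image : ∀ s {x y} → Adj (transport s) x y → Image s x y
  Adj⇒Image s {x} {y} e = does⇒ (image? s x y) (trans (sym (adj-transport s x y)) e)

  Image⇒Adj : ∀ s {x y} → Image s x y → Adj (transport s) x y
  Image⇒Adj s {x} {y} e = trans (adj-transport s x y) (dec-true (image? s x y) e)

  Adj-α : ∀ s {i j} → Image s (β i) (β j) → Adj s (α i) (α j)
  Adj-α s (i , j , p , q , e) with refl ← β-injective p | refl ← β-injective q = e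

  Covers : Graph a → Set
  Covers s = ∀ {v} → NonIsolated s v → ∃[ i ] α i ≡ v

  transport-≈ : ∀ s → Covers s → s ≈ transport s
  transport-≈ s cov = correspondence⇒≈ record
    { α = α ; β = β ; α-injective = α-injective ; β-injective = β-injective
    ; adj-αβ = λ i j → true⇔⇒≡ (λ e → Image⇒Adj s (i , j , refl , refl , e)) (λ e → Adj-α s (Adj⇒Image s e))
    ; α-covers = cov
    ; β-covers = λ { (u , e) → let (i , _ , p , _) = Adj⇒Image s e in i , p } }

  transport-reflects-⊆ : ∀ s t → Covers s → transport s ⊆ transport t → s ⊆ t
  transport-reflects-⊆ s t cov sub u v e
    with i , refl ← cov (v , e) | j , refl ← cov (u , Adj-sym s e) =
    Adj-α t (Adj⇒Image t (sub _ _ (Image⇒Adj s (i , j , refl , refl , e))))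

  transport-injective : ∀ s t → Covers s → Covers t → transport s ≡ transport t → s ≡ t
  transport-injective s t cs ct e = ⊆-antisym
    (transport-reflects-⊆ s t cs (subst (transport s ⊆_) e (⊆-refl (transport s))))
    (transport-reflects-⊆ t s ct (subst (_⊆ transport s) e (⊆-refl (transport s))))

module _ {A : ∀ {n} → Graph n → Set} (A? : ∀ {n} (g : Graph n) → Dec (A g))
         (A-resp : ∀ {a b} {g : Graph a} {h : Graph b} → g ≈ h → A g → A h) where

  -- The property `A` is left open for two uses: membership in a fixed class gives `I`, and the
  -- trivial property gives the number of all subgraphs, from which `size` is recovered.
  subgraphCount : Graph n → ℕ
  subgraphCount {n} h = length (filter (λ s → (s ⊆? h) ×-dec A? s) (allGraphs n))

  -- Transport injects the subgraphs of `g` into those of `h`: a non-isolated vertex of a subgraph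
  -- is non-isolated in `g`, hence covered. Symmetry of `≈` then gives equality.
  subgraphCount-≤ : {g : Graph a} {h : Graph b} → g ≈ h → subgraphCount g ≤ subgraphCount h
  subgraphCount-≤ {a} {b} {g} {h} g≈h = filter-length-≤ _ _ transport
    (λ {s} (s⊆g , As) → ⊆h s s⊆g , A-resp (transport-≈ s (covers s s⊆g)) As)
    (λ {s} {t} (s⊆g , _) (t⊆g , _) → transport-injective s t (covers s s⊆g) (covers t t⊆g))
    (allGraphs-unique a) allGraphs-complete
    where
    open Correspondence (≈⇒correspondence g≈h)
    open Transport α β α-injective β-injective
    covers : ∀ s → s ⊆ g → Covers s
    covers s s⊆g (u , e) = α-covers (u , s⊆g _ _ e)
    ⊆h : ∀ s → s ⊆ g → transport s ⊆ h
    ⊆h s s⊆g x y e with i , j , refl , refl , d ← Adj⇒Image s e =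
      trans (sym (adj-αβ i j)) (s⊆g _ _ d)

  subgraphCount-cong : {g : Graph a} {h : Graph b} → g ≈ h → subgraphCount g ≡ subgraphCount h
  subgraphCount-cong g≈h = ℕ.≤-antisym (subgraphCount-≤ g≈h) (subgraphCount-≤ (≈-sym g≈h))

I-congʳ : (f : Graph l) {g : Graph a} {h : Graph b} → g ≈ h → I f g ≡ I f h
I-congʳ f = subgraphCount-cong {A = λ s → core s ≅ core f} (λ s → core s ≅? core f)
  λ g≈h g≅f → _≈_.core≅ (≈-trans {k = f} (≈-sym g≈h) (mk≈ {h = f} g≅f))

-- Intervals of subsets and of subgraphs

record Ranked (X : Set) : Set₁ where
  infix 4 _⊑_ _⊑?_
  field
    elements : List X
    _⊑_      : X → X → Set
    _⊑?_     : ∀ v w → Dec (v ⊑ w)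
    rank     : X → ℕ

  -- The rank generating function of the interval from v to u is that of a
  -- Boolean lattice; at x = -1 it gives Möbius inversion, at x = 1 the number of elements.
  record BooleanInterval (v u : X) : Set where
    field
      codim   : ℕ
      rank-+  : rank u ≡ rank v ℕ.+ codim
      codim≡0 : codim ≡ 0 → v ≡ u
      sum     : ∀ x → Σ[ w ← elements ] (⟦ v ⊑? w ⟧ * ⟦ w ⊑? u ⟧ * x ^ rank w)
                      ≡ x ^ rank v * (1ℤ + x) ^ codim

open Ranked using (BooleanInterval)

module _ (A : Ranked X) (B : Ranked Y) (T : Ranked Z) where
  private
    module A = Ranked A
    module B = Ranked B
    module T = Ranked T

  -- The order indicators and `x ^ rank` are multiplicative over the two components, so the sum over
  -- the product splits and the codimensions add. Subsets are products of Booleans, and `_▸_` makes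
  -- a graph the product of a smaller graph and a subset.
  productInterval : (_∙_ : X → Y → Z) →
    T.elements ≡ cartesianProductWith _∙_ A.elements B.elements →
    (∀ {v w v′ w′} → v ∙ v′ T.⊑ w ∙ w′ → v A.⊑ w × v′ B.⊑ w′) →
    (∀ {v w v′ w′} → v A.⊑ w × v′ B.⊑ w′ → v ∙ v′ T.⊑ w ∙ w′) →
    (∀ v v′ → T.rank (v ∙ v′) ≡ A.rank v ℕ.+ B.rank v′) →
    ∀ {v u v′ u′} → BooleanInterval A v u → BooleanInterval B v′ u′ →
    BooleanInterval T (v ∙ v′) (u ∙ u′)
  productInterval _∙_ elems ⊑⇒ ⇒⊑ rank-∙ {v} {u} {v′} {u′} I J = record
    { codim = i ℕ.+ j
    ; rank-+ = begin
        T.rank (u ∙ u′)                               ≡⟨ rank-∙ u u′ ⟩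
        A.rank u ℕ.+ B.rank u′                        ≡⟨ cong₂ ℕ._+_ I.rank-+ J.rank-+ ⟩
        A.rank v ℕ.+ i ℕ.+ (B.rank v′ ℕ.+ j)          ≡⟨ ℕ-interchange (A.rank v) i (B.rank v′) j ⟩
        A.rank v ℕ.+ B.rank v′ ℕ.+ (i ℕ.+ j)          ≡⟨ cong (ℕ._+ (i ℕ.+ j)) (sym (rank-∙ v v′)) ⟩
        T.rank (v ∙ v′) ℕ.+ (i ℕ.+ j)                 ∎
    ; codim≡0 = λ e → cong₂ _∙_ (I.codim≡0 (ℕ.m+n≡0⇒m≡0 i e)) (J.codim≡0 (ℕ.m+n≡0⇒n≡0 i e))
    ; sum = λ x → begin
        Σ T.elements (λ w → ⟦ v ∙ v′ T.⊑? w ⟧ * ⟦ w T.⊑? u ∙ u′ ⟧ * x ^ T.rank w)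
          ≡⟨ cong (λ xs → Σ xs (λ w → ⟦ v ∙ v′ T.⊑? w ⟧ * ⟦ w T.⊑? u ∙ u′ ⟧ * x ^ T.rank w)) elems ⟩
        Σ (cartesianProductWith _∙_ A.elements B.elements)
          (λ w → ⟦ v ∙ v′ T.⊑? w ⟧ * ⟦ w T.⊑? u ∙ u′ ⟧ * x ^ T.rank w)
          ≡⟨ Σ-cartesianProductWith _∙_ A.elements B.elements _ ⟩
        Σ[ w ← A.elements ] Σ[ w′ ← B.elements ]
          (⟦ v ∙ v′ T.⊑? w ∙ w′ ⟧ * ⟦ w ∙ w′ T.⊑? u ∙ u′ ⟧ * x ^ T.rank (w ∙ w′))
          ≡⟨ Σ-cong A.elements (λ w → Σ-cong B.elements (factor x w)) ⟩
        Σ[ w ← A.elements ] Σ[ w′ ← B.elements ]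
          (⟦ v A.⊑? w ⟧ * ⟦ w A.⊑? u ⟧ * x ^ A.rank w *
           (⟦ v′ B.⊑? w′ ⟧ * ⟦ w′ B.⊑? u′ ⟧ * x ^ B.rank w′))
          ≡⟨ sym (Σ-*-Σ A.elements B.elements
               (λ w → ⟦ v A.⊑? w ⟧ * ⟦ w A.⊑? u ⟧ * x ^ A.rank w)
               (λ w′ → ⟦ v′ B.⊑? w′ ⟧ * ⟦ w′ B.⊑? u′ ⟧ * x ^ B.rank w′)) ⟩
        Σ[ w ← A.elements ] (⟦ v A.⊑? w ⟧ * ⟦ w A.⊑? u ⟧ * x ^ A.rank w) *
        Σ[ w′ ← B.elements ] (⟦ v′ B.⊑? w′ ⟧ * ⟦ w′ B.⊑? u′ ⟧ * x ^ B.rank w′)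
          ≡⟨ cong₂ _*_ (I.sum x) (J.sum x) ⟩
        x ^ A.rank v * (1ℤ + x) ^ i * (x ^ B.rank v′ * (1ℤ + x) ^ j)
          ≡⟨ *-interchange (x ^ A.rank v) ((1ℤ + x) ^ i) (x ^ B.rank v′) ((1ℤ + x) ^ j) ⟩
        x ^ A.rank v * x ^ B.rank v′ * ((1ℤ + x) ^ i * (1ℤ + x) ^ j)
          ≡⟨ cong₂ _*_ (sym (power x v v′)) (sym (ℤ.^-distribˡ-+-* (1ℤ + x) i j)) ⟩
        x ^ T.rank (v ∙ v′) * (1ℤ + x) ^ (i ℕ.+ j) ∎
    }
    where
    module I = BooleanInterval I
    module J = BooleanInterval J
    i j : ℕ
    i = I.codim
    j = J.codim
    ℕ-interchange : ∀ a b c d → a ℕ.+ b ℕ.+ (c ℕ.+ d) ≡ a ℕ.+ c ℕ.+ (b ℕ.+ d)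
    ℕ-interchange = ℕ-solve-∀
    *-interchange : ∀ a b c d → a * b * (c * d) ≡ a * c * (b * d)
    *-interchange = solve-∀
    shuffle : ∀ p p′ q q′ r r′ → p * p′ * (q * q′) * (r * r′) ≡ p * q * r * (p′ * q′ * r′)
    shuffle = solve-∀
    power : ∀ x w w′ → x ^ T.rank (w ∙ w′) ≡ x ^ A.rank w * x ^ B.rank w′
    power x w w′ = trans (cong (x ^_) (rank-∙ w w′)) (ℤ.^-distribˡ-+-* x (A.rank w) (B.rank w′))
    ⟦⊑⟧ : ∀ v w v′ w′ → ⟦ v ∙ v′ T.⊑? w ∙ w′ ⟧ ≡ ⟦ v A.⊑? w ⟧ * ⟦ v′ B.⊑? w′ ⟧
    ⟦⊑⟧ v w v′ w′ = trans
      (⟦⟧-cong (v ∙ v′ T.⊑? w ∙ w′) ((v A.⊑? w) ×-dec (v′ B.⊑? w′)) ⊑⇒ ⇒⊑)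
      (⟦⟧-× (v A.⊑? w) (v′ B.⊑? w′))
    factor : ∀ x w w′ → ⟦ v ∙ v′ T.⊑? w ∙ w′ ⟧ * ⟦ w ∙ w′ T.⊑? u ∙ u′ ⟧ * x ^ T.rank (w ∙ w′) ≡
      ⟦ v A.⊑? w ⟧ * ⟦ w A.⊑? u ⟧ * x ^ A.rank w * (⟦ v′ B.⊑? w′ ⟧ * ⟦ w′ B.⊑? u′ ⟧ * x ^ B.rank w′)
    factor x w w′ = trans
      (cong₂ _*_ (cong₂ _*_ (⟦⊑⟧ v w v′ w′) (⟦⊑⟧ w u w′ u′)) (power x w w′))
      (shuffle ⟦ v A.⊑? w ⟧ ⟦ v′ B.⊑? w′ ⟧ ⟦ w A.⊑? u ⟧ ⟦ w′ B.⊑? u′ ⟧ (x ^ A.rank w) (x ^ B.rank w′))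

𝔹 : Ranked Bool
𝔹 = record
  { elements = outside ∷ inside ∷ [] ; _⊑_ = _≤ᵇ_ ; _⊑?_ = Bool._≤?_
  ; rank = λ { true → 1 ; false → 0 } }

𝔹-interval : ∀ {v u} → v ≤ᵇ u → BooleanInterval 𝔹 v u
𝔹-interval f≤t = record
  { codim = 1 ; rank-+ = refl ; codim≡0 = λ () ; sum = identity }
  where
  identity : ∀ x → 1ℤ * 1ℤ * 1ℤ + (1ℤ * 1ℤ * (x * 1ℤ) + 0ℤ) ≡ 1ℤ * ((1ℤ + x) * 1ℤ)
  identity = solve-∀
𝔹-interval {true} b≤b = record
  { codim = 0 ; rank-+ = refl ; codim≡0 = λ _ → refl ; sum = identity }
  where
  identity : ∀ x → 0ℤ * 1ℤ * 1ℤ + (1ℤ * 1ℤ * (x * 1ℤ) + 0ℤ) ≡ x * 1ℤ * 1ℤ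
  identity = solve-∀
𝔹-interval {false} b≤b = record
  { codim = 0 ; rank-+ = refl ; codim≡0 = λ _ → refl ; sum = identity }
  where
  identity : ∀ x → 1ℤ * 1ℤ * 1ℤ + (1ℤ * 0ℤ * (x * 1ℤ) + 0ℤ) ≡ 1ℤ * 1ℤ
  identity = solve-∀

𝕊 : ∀ n → Ranked (Subset n)
𝕊 n = record
  { elements = allSubsets n ; _⊑_ = λ S T → S Subset.⊆ T ; _⊑?_ = Subset._⊆?_ ; rank = ∣_∣ }

∷-⊆⇒ : ∀ {x y} {S T : Subset n} → (x ∷ S) Subset.⊆ (y ∷ T) → x ≤ᵇ y × S Subset.⊆ T
∷-⊆⇒ {x = outside} {outside} sub = b≤b , Subset.drop-∷-⊆ sub
∷-⊆⇒ {x = outside} {inside}  sub = f≤t , Subset.drop-∷-⊆ sub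
∷-⊆⇒ {x = inside}  sub with here ← sub here = b≤b , Subset.drop-∷-⊆ sub

⇒∷-⊆ : ∀ {x y} {S T : Subset n} → x ≤ᵇ y × S Subset.⊆ T → (x ∷ S) Subset.⊆ (y ∷ T)
⇒∷-⊆ (f≤t , sub) = Subset.out⊆ sub
⇒∷-⊆ (b≤b , sub) = Subset.s⊆s sub

𝕊-interval : {S T : Subset n} → S Subset.⊆ T → BooleanInterval (𝕊 n) S T
𝕊-interval {S = []} {[]} _ = record
  { codim = 0 ; rank-+ = refl ; codim≡0 = λ _ → refl ; sum = λ _ → refl }
𝕊-interval {suc n} {x ∷ S} {y ∷ T} sub =
  productInterval 𝔹 (𝕊 n) (𝕊 (suc n)) _∷_ refl ∷-⊆⇒ ⇒∷-⊆
    (λ { true _ → refl ; false _ → refl })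
    (𝔹-interval (proj₁ (∷-⊆⇒ sub))) (𝕊-interval (proj₂ (∷-⊆⇒ sub)))

𝔾 : ∀ n → Ranked (Graph n)
𝔾 n = record { elements = allGraphs n ; _⊑_ = _⊆_ ; _⊑?_ = _⊆?_ ; rank = size }

▸-⊆⇒ : {g h : Graph n} {N M : Subset n} → (g ▸ N) ⊆ (h ▸ M) → g ⊆ h × N Subset.⊆ M
▸-⊆⇒ {N = N} {M} sub =
  (λ u v → sub (suc u) (suc v)) ,
  λ {v} v∈N → lookup⇒[]= v M (sub zero (suc v) ([]=⇒lookup v∈N))

⇒▸-⊆ : {g h : Graph n} {N M : Subset n} → g ⊆ h × N Subset.⊆ M → (g ▸ N) ⊆ (h ▸ M)
⇒▸-⊆ (p , q) zero    (suc v) e = []=⇒lookup (q (lookup⇒[]= v _ e))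
⇒▸-⊆ (p , q) (suc u) zero    e = []=⇒lookup (q (lookup⇒[]= u _ e))
⇒▸-⊆ (p , q) (suc u) (suc v) e = p u v e

𝔾-interval : {g h : Graph n} → g ⊆ h → BooleanInterval (𝔾 n) g h
𝔾-interval {g = ∅} {∅} _ = record
  { codim = 0 ; rank-+ = refl ; codim≡0 = λ _ → refl ; sum = λ _ → refl }
𝔾-interval {suc n} {g ▸ N} {h ▸ M} sub =
  productInterval (𝔾 n) (𝕊 n) (𝔾 (suc n)) _▸_ refl ▸-⊆⇒ ⇒▸-⊆ (λ _ _ → refl)
    (𝔾-interval (proj₁ (▸-⊆⇒ sub))) (𝕊-interval (proj₂ (▸-⊆⇒ sub)))

-- Supports and induced subgraphs

edgeless : ∀ n → Graph n
edgeless ℕ.zero  = ∅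
edgeless (suc n) = edgeless n ▸ Subset.⊥

size-edgeless : ∀ n → size (edgeless n) ≡ 0
size-edgeless ℕ.zero  = refl
size-edgeless (suc n) = cong₂ ℕ._+_ (size-edgeless n) (Subset.∣⊥∣≡0 n)

edgeless-⊆ : (g : Graph n) → edgeless n ⊆ g
edgeless-⊆ ∅       ()
edgeless-⊆ (g ▸ N) = ⇒▸-⊆ (edgeless-⊆ g , Subset.⊆-min N)

module Interval {n} (g h : Graph n) (g⊆h : g ⊆ h) = Ranked.BooleanInterval (𝔾-interval {g = g} {h} g⊆h)

module Below {n} (h : Graph n) where
  open Interval (edgeless n) h (edgeless-⊆ h)

  codim≡size : codim ≡ size h
  codim≡size = sym (trans rank-+ (cong (ℕ._+ codim) (size-edgeless n)))

  -- The interval sum from the edgeless graph up to `h`. At `x = 1` it gives the number of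
  -- subgraphs, and at `x = -1` a power of 0, which vanishes unless `h` has no edge.
  rankSum : ∀ x → Σ[ w ← allGraphs n ] (⟦ w ⊆? h ⟧ * x ^ size w) ≡ (1ℤ + x) ^ size h
  rankSum x = begin
    Σ[ w ← allGraphs n ] (⟦ w ⊆? h ⟧ * x ^ size w)
      ≡⟨ Σ-cong (allGraphs n) (λ w → cong (_* x ^ size w)
           (sym (trans (cong (_* ⟦ w ⊆? h ⟧) (⟦⟧-yes (edgeless n ⊆? w) (edgeless-⊆ w))) (ℤ.*-identityˡ _)))) ⟩
    Σ[ w ← allGraphs n ] (⟦ edgeless n ⊆? w ⟧ * ⟦ w ⊆? h ⟧ * x ^ size w)
      ≡⟨ sum x ⟩
    x ^ size (edgeless n) * (1ℤ + x) ^ codim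
      ≡⟨ cong₂ (λ i j → x ^ i * (1ℤ + x) ^ j) (size-edgeless n) codim≡size ⟩
    1ℤ * (1ℤ + x) ^ size h
      ≡⟨ ℤ.*-identityˡ _ ⟩
    (1ℤ + x) ^ size h ∎

size≡0⇒edgeless : (g : Graph n) → size g ≡ 0 → edgeless n ≡ g
size≡0⇒edgeless {n} g e = codim≡0 (trans (Below.codim≡size g) e)
  where open Interval (edgeless n) g (edgeless-⊆ g)

2^-injective : ∀ i j → (pos 2) ^ i ≡ (pos 2) ^ j → i ≡ j
2^-injective ℕ.zero  ℕ.zero  e = refl
-- The left side is 1 and the right side is even.
2^-injective ℕ.zero  (suc j) e = contradiction
  (sym (trans (cong ℤ.∣_∣ e) (ℤ.∣i*j∣≡∣i∣*∣j∣ (pos 2) (pos 2 ^ j))))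
  (ℕ.even≢odd ℤ.∣ pos 2 ^ j ∣ 0)
2^-injective (suc i) ℕ.zero  e = sym (2^-injective ℕ.zero (suc i) (sym e))
2^-injective (suc i) (suc j) e = cong suc (2^-injective i j (ℤ.*-cancelˡ-≡ (pos 2) _ _ e))

-- A graph has `2 ^ size` subgraphs, and that number is already known to be invariant. This avoids
-- following the edge count through a permutation of the triangular encoding.
≈-size : {g : Graph a} {h : Graph b} → g ≈ h → size g ≡ size h
≈-size {a} {b} {g} {h} g≈h = 2^-injective _ _ (begin
  pos 2 ^ size g                ≡⟨ sym (count g) ⟩
  pos (subgraphCount _ _ g)     ≡⟨ cong pos (subgraphCount-cong (λ _ → yes _) _ g≈h) ⟩
  pos (subgraphCount _ _ h)     ≡⟨ count h ⟩
  pos 2 ^ size h                ∎)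
  where
  count : ∀ {n} (k : Graph n) → pos (subgraphCount {A = λ _ → ⊤} (λ _ → yes _) _ k) ≡ pos 2 ^ size k
  count {n} k = begin
    pos (subgraphCount {A = λ _ → ⊤} (λ _ → yes _) _ k)         ≡⟨ length-filter _ (allGraphs n) ⟩
    Σ[ s ← allGraphs n ] ⟦ (s ⊆? k) ×-dec yes _ ⟧
      ≡⟨ Σ-cong (allGraphs n) (λ s → trans (⟦⟧-× (s ⊆? k) (yes _))
           (cong (⟦ s ⊆? k ⟧ *_) (sym (ℤ.^-zeroˡ (size s))))) ⟩
    Σ[ s ← allGraphs n ] (⟦ s ⊆? k ⟧ * 1ℤ ^ size s)             ≡⟨ Below.rankSum k 1ℤ ⟩
    pos 2 ^ size k ∎

-- Counting the supersets of a given size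

Σ-∷ : ∀ {n} (f : Subset (suc n) → ℤ) →
      Σ (allSubsets (suc n)) f ≡ Σ[ S ← allSubsets n ] f (outside ∷ S) + Σ[ S ← allSubsets n ] f (inside ∷ S)
Σ-∷ {n} f = trans
  (Σ-cartesianProductWith _∷_ (outside ∷ inside ∷ []) (allSubsets n) f)
  (cong (Σ[ S ← allSubsets n ] f (outside ∷ S) +_) (ℤ.+-identityʳ _))

-- Induction on the ground set. A vertex of `T` is forced into `S`; any other vertex may be left out
-- or put in, and the two cases add up by Pascal's rule. Writing the size as `∣ T ∣ + d` keeps
-- truncated subtraction out of the induction.
superset-count : (T : Subset n) (d : ℕ) →
  Σ[ S ← allSubsets n ] (⟦ T Subset.⊆? S ⟧ * ⟦ ∣ S ∣ ℕ.≟ ∣ T ∣ ℕ.+ d ⟧) ≡ pos ((n ℕ.∸ ∣ T ∣) C d)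
superset-count [] ℕ.zero  = refl
superset-count [] (suc d) = refl
superset-count {suc n} (inside ∷ T) d = begin
  Σ[ S ← allSubsets (suc n) ] F S
    ≡⟨ Σ-∷ F ⟩
  Σ[ S ← allSubsets n ] F (outside ∷ S) + Σ[ S ← allSubsets n ] F (inside ∷ S)
    ≡⟨ cong₂ _+_
         (Σ-zero′ (allSubsets n) λ S → cong (_* ⟦ ∣ S ∣ ℕ.≟ suc (∣ T ∣ ℕ.+ d) ⟧)
           (⟦⟧-no ((inside ∷ T) Subset.⊆? (outside ∷ S)) λ sub → contradiction (sub here) λ ()))
         (Σ-cong (allSubsets n) λ S → cong₂ _*_
           (⟦⟧-cong ((inside ∷ T) Subset.⊆? (inside ∷ S)) (T Subset.⊆? S) Subset.drop-∷-⊆ Subset.s⊆s)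
           (⟦⟧-cong (suc ∣ S ∣ ℕ.≟ suc (∣ T ∣ ℕ.+ d)) (∣ S ∣ ℕ.≟ ∣ T ∣ ℕ.+ d) ℕ.suc-injective (cong suc))) ⟩
  0ℤ + Σ[ S ← allSubsets n ] (⟦ T Subset.⊆? S ⟧ * ⟦ ∣ S ∣ ℕ.≟ ∣ T ∣ ℕ.+ d ⟧)
    ≡⟨ ℤ.+-identityˡ _ ⟩
  Σ[ S ← allSubsets n ] (⟦ T Subset.⊆? S ⟧ * ⟦ ∣ S ∣ ℕ.≟ ∣ T ∣ ℕ.+ d ⟧)
    ≡⟨ superset-count T d ⟩
  pos ((n ℕ.∸ ∣ T ∣) C d) ∎
  where
  F : Subset (suc n) → ℤ
  F S = ⟦ (inside ∷ T) Subset.⊆? S ⟧ * ⟦ ∣ S ∣ ℕ.≟ suc (∣ T ∣ ℕ.+ d) ⟧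
superset-count {suc n} (outside ∷ T) d = begin
  Σ[ S ← allSubsets (suc n) ] F S
    ≡⟨ Σ-∷ F ⟩
  Σ[ S ← allSubsets n ] F (outside ∷ S) + Σ[ S ← allSubsets n ] F (inside ∷ S)
    ≡⟨ cong₂ _+_
         (trans (Σ-cong (allSubsets n) λ S → cong (_* ⟦ ∣ S ∣ ℕ.≟ ∣ T ∣ ℕ.+ d ⟧) (out outside S)) (superset-count T d))
         (trans (Σ-cong (allSubsets n) λ S → cong (_* ⟦ suc ∣ S ∣ ℕ.≟ ∣ T ∣ ℕ.+ d ⟧) (out inside S)) (next d)) ⟩
  pos ((n ℕ.∸ ∣ T ∣) C d) + pos (previous d)
    ≡⟨ pascal d ⟩
  pos (suc (n ℕ.∸ ∣ T ∣) C d)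
    ≡⟨ cong (λ e → pos (e C d)) (sym (ℕ.+-∸-assoc 1 (Subset.∣p∣≤n T))) ⟩
  pos ((suc n ℕ.∸ ∣ T ∣) C d) ∎
  where
  F : Subset (suc n) → ℤ
  F S = ⟦ (outside ∷ T) Subset.⊆? S ⟧ * ⟦ ∣ S ∣ ℕ.≟ ∣ T ∣ ℕ.+ d ⟧
  out : ∀ x S → ⟦ (outside ∷ T) Subset.⊆? (x ∷ S) ⟧ ≡ ⟦ T Subset.⊆? S ⟧
  out x S = ⟦⟧-cong ((outside ∷ T) Subset.⊆? (x ∷ S)) (T Subset.⊆? S) Subset.drop-∷-⊆ Subset.out⊆
  -- The binomial coefficient with lower index `d - 1`, read as 0 for `d = 0`: no superset of `T` is
  -- smaller than `T`.
  previous : ℕ → ℕ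
  previous ℕ.zero  = 0
  previous (suc d) = (n ℕ.∸ ∣ T ∣) C d
  next : ∀ d → Σ[ S ← allSubsets n ] (⟦ T Subset.⊆? S ⟧ * ⟦ suc ∣ S ∣ ℕ.≟ ∣ T ∣ ℕ.+ d ⟧) ≡ pos (previous d)
  next ℕ.zero = Σ-zero′ (allSubsets n) λ S → ⟦⟧-*-zero (T Subset.⊆? S) λ T⊆S →
    ⟦⟧-no (suc ∣ S ∣ ℕ.≟ ∣ T ∣ ℕ.+ 0) λ e → ℕ.<-irrefl refl
      (ℕ.≤-trans (ℕ.≤-reflexive (trans e (ℕ.+-identityʳ _))) (Subset.p⊆q⇒∣p∣≤∣q∣ T⊆S))
  next (suc d) = trans
    (Σ-cong (allSubsets n) λ S → cong (⟦ T Subset.⊆? S ⟧ *_)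
      (⟦⟧-cong (suc ∣ S ∣ ℕ.≟ ∣ T ∣ ℕ.+ suc d) (∣ S ∣ ℕ.≟ ∣ T ∣ ℕ.+ d)
        (λ e → ℕ.suc-injective (trans e (ℕ.+-suc _ _))) (λ e → trans (cong suc e) (sym (ℕ.+-suc _ _)))))
    (superset-count T d)
  pascal : ∀ d → pos ((n ℕ.∸ ∣ T ∣) C d) + pos (previous d) ≡ pos (suc (n ℕ.∸ ∣ T ∣) C d)
  pascal ℕ.zero  = refl
  pascal (suc d) = cong pos (trans (ℕ.+-comm ((n ℕ.∸ ∣ T ∣) C suc d) _) (nCk+nC[k+1]≡[n+1]C[k+1] (n ℕ.∸ ∣ T ∣) d))

-- Unlike the binomial coefficient with truncated differences, this is 0 for `k < ∣ T ∣`, in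
-- agreement with the last case of `f`.
supersetsOfSize : Subset n → ℕ → ℤ
supersetsOfSize {n} T k = Σ[ S ← allSubsets n ] (⟦ T Subset.⊆? S ⟧ * ⟦ ∣ S ∣ ℕ.≟ k ⟧)

supersetsOfSize-≤ : (T : Subset n) {k : ℕ} → ∣ T ∣ ≤ k →
                    supersetsOfSize T k ≡ pos ((n ℕ.∸ ∣ T ∣) C (k ℕ.∸ ∣ T ∣))
supersetsOfSize-≤ T {k} le = trans
  (cong (supersetsOfSize T) (sym (ℕ.m+[n∸m]≡n le)))
  (superset-count T (k ℕ.∸ ∣ T ∣))

supersetsOfSize-> : (T : Subset n) {k : ℕ} → ¬ ∣ T ∣ ≤ k → supersetsOfSize T k ≡ 0ℤ
supersetsOfSize-> {n} T {k} gt = Σ-zero′ (allSubsets n) λ S → ⟦⟧-*-zero (T Subset.⊆? S) λ T⊆S →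
  ⟦⟧-no (∣ S ∣ ℕ.≟ k) λ { refl → gt (Subset.p⊆q⇒∣p∣≤∣q∣ T⊆S) }

support : Graph n → Subset n
support g = Vec.tabulate λ v → does (nonIsolated? g v)

∈support⇒ : (g : Graph n) → ∀ {v} → v Subset.∈ support g → NonIsolated g v
∈support⇒ g {v} v∈ = does⇒ (nonIsolated? g v) (trans (sym (lookup∘tabulate _ v)) ([]=⇒lookup v∈))

⇒∈support : (g : Graph n) → ∀ {v} → NonIsolated g v → v Subset.∈ support g
⇒∈support g {v} nv =
  lookup⇒[]= v (support g) (trans (lookup∘tabulate _ v) (dec-true (nonIsolated? g v) nv))

∣tabulate-does∣ : {P : Fin n → Set} (P? : ∀ v → Dec (P v)) →
                  ∣ Vec.tabulate (λ v → does (P? v)) ∣ ≡ length (filter P? (allFin n))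
∣tabulate-does∣ {n} P? = go P? id
  where
  go : ∀ {m} {P : Fin n → Set} (P? : ∀ v → Dec (P v)) (h : Fin m → Fin n) →
       ∣ Vec.tabulate (λ v → does (P? (h v))) ∣ ≡ length (filter P? (List.tabulate h))
  go {ℕ.zero} P? h = refl
  go {suc m}  P? h with does (P? (h zero))
  ... | true  = cong suc (go P? (h ∘ suc))
  ... | false = go P? (h ∘ suc)

∣support∣ : (g : Graph n) → ∣ support g ∣ ≡ cv g
∣support∣ g = ∣tabulate-does∣ (nonIsolated? g)

cv-⊆ : {g h : Graph n} → g ⊆ h → cv g ≤ cv h
cv-⊆ {g = g} {h} g⊆h = ℕ.≤-trans (ℕ.≤-reflexive (sym (∣support∣ g))) (ℕ.≤-trans
  (Subset.p⊆q⇒∣p∣≤∣q∣ λ {v} v∈ → let (u , e) = ∈support⇒ g v∈ in ⇒∈support h (u , g⊆h v u e))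
  (ℕ.≤-reflexive (∣support∣ h)))

cv≤n : (g : Graph n) → cv g ≤ n
cv≤n g = subst (_≤ _) (∣support∣ g) (Subset.∣p∣≤n (support g))

-- The induced graph on `S`, kept on all `n` vertices by isolating the others. Its subgraphs are
-- then literally subgraphs of `g`, and the added isolated vertices are invisible to `≈`.
restrict : Graph n → Subset n → Graph n
restrict g S = fromAdj λ u v → adj g u v ∧ (lookup S u ∧ lookup S v)

adj-restrict : (g : Graph n) (S : Subset n) → ∀ u v →
               adj (restrict g S) u v ≡ adj g u v ∧ (lookup S u ∧ lookup S v)
adj-restrict g S = adj-fromAdj _
  (λ v → cong (_∧ (lookup S v ∧ lookup S v)) (adj-irrefl g v))
  (λ u v → cong₂ _∧_ (adj-sym g u v) (Bool.∧-comm (lookup S u) (lookup S v)))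

∧-true : ∀ {x y z} → x ∧ (y ∧ z) ≡ true → x ≡ true × y ≡ true × z ≡ true
∧-true {true} {true} {true} _ = refl , refl , refl

∧-intro : ∀ {x y z} → x ≡ true → y ≡ true → z ≡ true → x ∧ (y ∧ z) ≡ true
∧-intro refl refl refl = refl

restrict⇒ : (g : Graph n) (S : Subset n) → ∀ {u v} → Adj (restrict g S) u v →
            Adj g u v × lookup S u ≡ true × lookup S v ≡ true
restrict⇒ g S {u} {v} e = ∧-true (trans (sym (adj-restrict g S u v)) e)

⊆restrict⇒ : (s g : Graph n) (S : Subset n) → s ⊆ restrict g S → s ⊆ g × support s Subset.⊆ S
⊆restrict⇒ s g S sub =
  (λ u v e → proj₁ (restrict⇒ g S (sub u v e))) ,
  λ {v} v∈ → let (u , e) = ∈support⇒ s v∈ in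
    lookup⇒[]= v S (proj₁ (proj₂ (restrict⇒ g S (sub v u e))))

⇒⊆restrict : (s g : Graph n) (S : Subset n) → s ⊆ g × support s Subset.⊆ S → s ⊆ restrict g S
⇒⊆restrict s g S (s⊆g , sub) u v e = trans (adj-restrict g S u v) (∧-intro (s⊆g u v e)
  ([]=⇒lookup (sub (⇒∈support s (v , e)))) ([]=⇒lookup (sub (⇒∈support s (u , Adj-sym s e)))))

⟦⊆restrict⟧ : (s g : Graph n) (S : Subset n) →
              ⟦ s ⊆? restrict g S ⟧ ≡ ⟦ s ⊆? g ⟧ * ⟦ support s Subset.⊆? S ⟧
⟦⊆restrict⟧ s g S = trans
  (⟦⟧-cong (s ⊆? restrict g S) ((s ⊆? g) ×-dec (support s Subset.⊆? S)) (⊆restrict⇒ s g S) (⇒⊆restrict s g S))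
  (⟦⟧-× (s ⊆? g) (support s Subset.⊆? S))

cv-restrict : (g : Graph n) (S : Subset n) → cv (restrict g S) ≤ ∣ S ∣
cv-restrict g S = subst (_≤ ∣ S ∣) (∣support∣ (restrict g S))
  (Subset.p⊆q⇒∣p∣≤∣q∣ (proj₂ (⊆restrict⇒ (restrict g S) g S (⊆-refl (restrict g S)))))

-- Sums over isomorphism classes

I-sum : (f : Graph l) (h : Graph n) → pos (I f h) ≡ Σ[ s ← allGraphs n ] (⟦ s ⊆? h ⟧ * ⟦ s ≈? f ⟧)
I-sum {n = n} f h = trans
  (length-filter (λ s → (s ⊆? h) ×-dec (core s ≅? core f)) (allGraphs n))
  (Σ-cong (allGraphs n) λ s → trans
    (⟦⟧-× (s ⊆? h) (core s ≅? core f))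
    (cong (⟦ s ⊆? h ⟧ *_) (⟦⟧-cong (core s ≅? core f) (s ≈? f) mk≈ _≈_.core≅)))

if-yes : {p : Dec P} {x y : X} → P → (if does p then x else y) ≡ x
if-yes {p = yes _} _ = refl
if-yes {p = no ¬p} p = contradiction p ¬p

if-no : {p : Dec P} {x y : X} → ¬ P → (if does p then x else y) ≡ y
if-no {p = yes p} ¬p = contradiction p ¬p
if-no {p = no _}  _  = refl

diag-≡ : (d : Fin n → ℤ) → ∀ i → diag d i i ≡ d i
diag-≡ d i = if-yes {p = i Fin.≟ i} refl

diag-≢ : (d : Fin n → ℤ) → ∀ {i j} → i ≢ j → diag d i j ≡ 0ℤ
diag-≢ d {i} {j} i≢j = if-no {p = i Fin.≟ j} i≢j

module _ (𝓔 : Representatives r m) where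
  open Representatives 𝓔 using (g; complete)

  -- The core of `s` fits into `r` vertices; placed there and padded with isolated vertices it is a
  -- graph of order `r`, to which `complete` applies.
  class : (s : Graph n) → cv s ≤ r → ∃[ i ] s ≈ g i
  class s le =
    let (i , t≅gᵢ) = complete (transport s)
    in i , ≈-trans (transport-≈ s (ι-covers s)) (≅⇒≈ {g = transport s} {g i} t≅gᵢ)
    where
    open Transport (ι s) (λ i → inject≤ i le) (ι-injective s)
      (λ {i} {j} → Fin.inject≤-injective le le i j)

  module _ (E⁻¹ : Matrix (suc m)) (inverse : IsInverse (E 𝓔) E⁻¹) where

    -- Isomorphic cores would give E two equal rows.
    distinct-≈ : ∀ {i j} → g i ≈ g j → i ≡ j
    distinct-≈ {i} {j} gᵢ≈gⱼ = decidable-stable (i Fin.≟ j) λ i≢j →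
      contradiction (begin
        0ℤ                ≡⟨ sym (diag-≢ (λ _ → 1ℤ) i≢j) ⟩
        𝟙 i j             ≡⟨ sym (proj₁ inverse i j) ⟩
        (E 𝓔 · E⁻¹) i j   ≡⟨ rows ⟩
        (E 𝓔 · E⁻¹) j j   ≡⟨ proj₁ inverse j j ⟩
        𝟙 j j             ≡⟨ diag-≡ (λ _ → 1ℤ) j ⟩
        1ℤ                ∎) λ ()
      where
      row : Fin (suc m) → Fin (suc m) → ℤ
      row k h = E 𝓔 k h * E⁻¹ h j
      rows : (E 𝓔 · E⁻¹) i j ≡ (E 𝓔 · E⁻¹) j j
      rows = trans (∑≡Σ (suc m) (row i)) (trans
        (Σ-cong (allFin (suc m)) λ h → cong (λ e → pos e * E⁻¹ h j) (I-congʳ (g h) gᵢ≈gⱼ))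
        (sym (∑≡Σ (suc m) (row j))))

    atClass : (ψ : Fin (suc m) → ℤ) (s : Graph n) → ∀ {i} → s ≈ g i →
              Σ[ j ← allFin (suc m) ] (ψ j * ⟦ s ≈? g j ⟧) ≡ ψ i
    atClass ψ s {i} s≈gᵢ = trans
      (Σ-single (Unique.allFin⁺ (suc m)) (∈-allFin i) λ j j≢i →
        trans (cong (ψ j *_) (⟦⟧-no (s ≈? g j) λ s≈gⱼ → j≢i (distinct-≈ (≈-trans (≈-sym s≈gⱼ) s≈gᵢ))))
              (ℤ.*-zeroʳ (ψ j)))
      (trans (cong (ψ i *_) (⟦⟧-yes (s ≈? g i) s≈gᵢ)) (ℤ.*-identityʳ (ψ i)))

    -- Regroups a sum over subgraphs by isomorphism class. A subgraph with more than `r`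
    -- non-isolated vertices belongs to no `g i`, so `φ` has to vanish on it.
    classSum : (h : Graph n) (φ : Graph n → ℤ) (ψ : Fin (suc m) → ℤ) →
      (∀ s i → s ⊆ h → s ≈ g i → φ s ≡ ψ i) → (∀ s → s ⊆ h → ¬ cv s ≤ r → φ s ≡ 0ℤ) →
      Σ[ s ← allGraphs n ] (⟦ s ⊆? h ⟧ * φ s) ≡ Σ[ i ← allFin (suc m) ] (ψ i * pos (I (g i) h))
    classSum {n} h φ ψ φ≡ψ φ≡0 = begin
      Σ[ s ← allGraphs n ] (⟦ s ⊆? h ⟧ * φ s)
        ≡⟨ Σ-cong (allGraphs n) (λ s → ⟦⟧-*-cong (s ⊆? h) (decompose s)) ⟩
      Σ[ s ← allGraphs n ] (⟦ s ⊆? h ⟧ * Σ[ i ← allFin (suc m) ] (ψ i * ⟦ s ≈? g i ⟧))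
        ≡⟨ Σ-cong (allGraphs n) (λ s → *-distribˡ-Σ (allFin (suc m)) ⟦ s ⊆? h ⟧ _) ⟩
      Σ[ s ← allGraphs n ] Σ[ i ← allFin (suc m) ] (⟦ s ⊆? h ⟧ * (ψ i * ⟦ s ≈? g i ⟧))
        ≡⟨ Σ-comm (allGraphs n) (allFin (suc m)) _ ⟩
      Σ[ i ← allFin (suc m) ] Σ[ s ← allGraphs n ] (⟦ s ⊆? h ⟧ * (ψ i * ⟦ s ≈? g i ⟧))
        ≡⟨ Σ-cong (allFin (suc m)) (λ i → Σ-cong (allGraphs n) λ s → swap ⟦ s ⊆? h ⟧ (ψ i) ⟦ s ≈? g i ⟧) ⟩
      Σ[ i ← allFin (suc m) ] Σ[ s ← allGraphs n ] (ψ i * (⟦ s ⊆? h ⟧ * ⟦ s ≈? g i ⟧))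
        ≡⟨ Σ-cong (allFin (suc m)) (λ i → sym (trans (cong (ψ i *_) (I-sum (g i) h)) (*-distribˡ-Σ (allGraphs n) (ψ i) _))) ⟩
      Σ[ i ← allFin (suc m) ] (ψ i * pos (I (g i) h)) ∎
      where
      swap : ∀ x y z → x * (y * z) ≡ y * (x * z)
      swap = solve-∀
      decompose : ∀ s → s ⊆ h → φ s ≡ Σ[ i ← allFin (suc m) ] (ψ i * ⟦ s ≈? g i ⟧)
      decompose s s⊆h = [ small , large ]′ (toSum (cv s ℕ.≤? r))
        where
        small : cv s ≤ r → φ s ≡ Σ[ i ← allFin (suc m) ] (ψ i * ⟦ s ≈? g i ⟧)
        small le = let (i , s≈gᵢ) = class s le in trans (φ≡ψ s i s⊆h s≈gᵢ) (sym (atClass ψ s s≈gᵢ))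
        large : ¬ cv s ≤ r → φ s ≡ Σ[ i ← allFin (suc m) ] (ψ i * ⟦ s ≈? g i ⟧)
        large gt = trans (φ≡0 s s⊆h gt) (sym (Σ-zero′ (allFin (suc m)) λ i →
          trans (cong (ψ i *_) (⟦⟧-no (s ≈? g i) λ s≈gᵢ → gt (subst (_≤ r) (sym (≈-cv s≈gᵢ)) (cv≤n (g i)))))
                (ℤ.*-zeroʳ (ψ i))))

-- Möbius inversion over subgraphs

union : Graph n → Graph n → Graph n
union s t = fromAdj λ u v → adj s u v ∨ adj t u v

adj-union : (s t : Graph n) → ∀ u v → adj (union s t) u v ≡ adj s u v ∨ adj t u v
adj-union s t = adj-fromAdj _
  (λ v → cong₂ _∨_ (adj-irrefl s v) (adj-irrefl t v))
  (λ u v → cong₂ _∨_ (adj-sym s u v) (adj-sym t u v))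

∨-true : ∀ {x y} → x ∨ y ≡ true → x ≡ true ⊎ y ≡ true
∨-true {true}  _ = inj₁ refl
∨-true {false} e = inj₂ e

Adj-union : (s t : Graph n) → ∀ {u v} → Adj (union s t) u v → Adj s u v ⊎ Adj t u v
Adj-union s t {u} {v} e = ∨-true (trans (sym (adj-union s t u v)) e)

⊆-unionˡ : (s t : Graph n) → s ⊆ union s t
⊆-unionˡ s t u v e = trans (adj-union s t u v) (cong (_∨ adj t u v) e)

⊆-unionʳ : (s t : Graph n) → t ⊆ union s t
⊆-unionʳ s t u v e =
  trans (adj-union s t u v) (trans (cong (adj s u v ∨_) e) (Bool.∨-zeroʳ (adj s u v)))

union-⊆ : (s t w : Graph n) → s ⊆ w × t ⊆ w → union s t ⊆ w
union-⊆ s t w (p , q) u v e = [ p u v , q u v ]′ (Adj-union s t e)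

⟦union⊆⟧ : (s t w : Graph n) → ⟦ union s t ⊆? w ⟧ ≡ ⟦ s ⊆? w ⟧ * ⟦ t ⊆? w ⟧
⟦union⊆⟧ s t w = trans
  (⟦⟧-cong (union s t ⊆? w) ((s ⊆? w) ×-dec (t ⊆? w))
    (λ p → ⊆-trans {g = s} {h = union s t} {k = w} (⊆-unionˡ s t) p
         , ⊆-trans {g = t} {h = union s t} {k = w} (⊆-unionʳ s t) p)
    (union-⊆ s t w))
  (⟦⟧-× (s ⊆? w) (t ⊆? w))

∣p∪q∣≤∣p∣+∣q∣ : (p q : Subset n) → ∣ p Subset.∪ q ∣ ≤ ∣ p ∣ ℕ.+ ∣ q ∣
∣p∪q∣≤∣p∣+∣q∣ [] [] = ℕ.z≤n
∣p∪q∣≤∣p∣+∣q∣ (outside ∷ p) (outside ∷ q) = ∣p∪q∣≤∣p∣+∣q∣ p q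
∣p∪q∣≤∣p∣+∣q∣ (outside ∷ p) (inside  ∷ q) =
  ℕ.≤-trans (ℕ.s≤s (∣p∪q∣≤∣p∣+∣q∣ p q)) (ℕ.≤-reflexive (sym (ℕ.+-suc ∣ p ∣ ∣ q ∣)))
∣p∪q∣≤∣p∣+∣q∣ (inside  ∷ p) (outside ∷ q) = ℕ.s≤s (∣p∪q∣≤∣p∣+∣q∣ p q)
∣p∪q∣≤∣p∣+∣q∣ (inside  ∷ p) (inside  ∷ q) =
  ℕ.s≤s (ℕ.≤-trans (∣p∪q∣≤∣p∣+∣q∣ p q) (ℕ.+-monoʳ-≤ ∣ p ∣ (ℕ.n≤1+n ∣ q ∣)))

cv-union : (s t : Graph n) → cv (union s t) ≤ cv s ℕ.+ cv t
cv-union s t = subst₂ _≤_ (∣support∣ (union s t)) (cong₂ ℕ._+_ (∣support∣ s) (∣support∣ t))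
  (ℕ.≤-trans (Subset.p⊆q⇒∣p∣≤∣q∣ sub) (∣p∪q∣≤∣p∣+∣q∣ (support s) (support t)))
  where
  sub : support (union s t) Subset.⊆ support s Subset.∪ support t
  sub v∈ = let (u , e) = ∈support⇒ (union s t) v∈ in Subset.x∈p∪q⁺
    (Sum.map (λ d → ⇒∈support s (u , d)) (λ d → ⇒∈support t (u , d)) (Adj-union s t e))

sign-* : ∀ a b → sign a b ≡ -1ℤ ^ a * -1ℤ ^ b
sign-* ℕ.zero  ℕ.zero  = refl
sign-* ℕ.zero  (suc b) = sym (ℤ.*-identityˡ _)
sign-* (suc a) ℕ.zero  = sym (ℤ.*-identityʳ _)
sign-* (suc a) (suc b) = trans (sign-* a b) (cancel (-1ℤ ^ a) (-1ℤ ^ b))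
  where
  cancel : ∀ x y → x * y ≡ -1ℤ * x * (-1ℤ * y)
  cancel = solve-∀

sign-refl : ∀ a → sign a a ≡ 1ℤ
sign-refl a = cong (-1ℤ ^_) (ℕ.∣n-n∣≡0 a)

-- The convolution of the zeta function with the Möbius function of a Boolean lattice, hence the
-- identity of the incidence algebra: 1 for `v = u` and 0 otherwise.
möbius : Graph n → Graph n → ℤ
möbius {n} v u = Σ[ w ← allGraphs n ] (⟦ v ⊆? w ⟧ * ⟦ w ⊆? u ⟧ * sign (size u) (size w))

-- The sign splits into a factor for `u` and a factor for `w`; the interval sum at `x = -1` then
-- leaves a power of `1 - 1`.
möbius-sum : {v u : Graph n} (v⊆u : v ⊆ u) →
  möbius v u ≡ sign (size u) (size v) * 0ℤ ^ Ranked.BooleanInterval.codim (𝔾-interval {g = v} {u} v⊆u)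
möbius-sum {n} {v} {u} v⊆u = begin
  möbius v u
    ≡⟨ Σ-cong (allGraphs n) (λ w → trans
         (cong (⟦ v ⊆? w ⟧ * ⟦ w ⊆? u ⟧ *_) (sign-* (size u) (size w)))
         (pull ⟦ v ⊆? w ⟧ ⟦ w ⊆? u ⟧ (-1ℤ ^ size u) (-1ℤ ^ size w))) ⟩
  Σ[ w ← allGraphs n ] (-1ℤ ^ size u * (⟦ v ⊆? w ⟧ * ⟦ w ⊆? u ⟧ * -1ℤ ^ size w))
    ≡⟨ sym (*-distribˡ-Σ (allGraphs n) (-1ℤ ^ size u) _) ⟩
  -1ℤ ^ size u * Σ[ w ← allGraphs n ] (⟦ v ⊆? w ⟧ * ⟦ w ⊆? u ⟧ * -1ℤ ^ size w)
    ≡⟨ cong (-1ℤ ^ size u *_) (sum -1ℤ) ⟩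
  -1ℤ ^ size u * (-1ℤ ^ size v * 0ℤ ^ codim)
    ≡⟨ sym (ℤ.*-assoc (-1ℤ ^ size u) (-1ℤ ^ size v) (0ℤ ^ codim)) ⟩
  -1ℤ ^ size u * -1ℤ ^ size v * 0ℤ ^ codim
    ≡⟨ cong (_* 0ℤ ^ codim) (sym (sign-* (size u) (size v))) ⟩
  sign (size u) (size v) * 0ℤ ^ codim ∎
  where
  open Interval v u v⊆u
  pull : ∀ p q x y → p * q * (x * y) ≡ x * (p * q * y)
  pull = solve-∀

möbius-refl : (u : Graph n) → möbius u u ≡ 1ℤ
möbius-refl u = trans (möbius-sum {v = u} {u} (⊆-refl u)) (cong₂ (λ x i → x * 0ℤ ^ i)
  (sign-refl (size u))
  (ℕ.+-cancelˡ-≡ (size u) _ 0 (trans (sym rank-+) (sym (ℕ.+-identityʳ _)))))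
  where open Interval u u (⊆-refl u)

0^n≡0 : ∀ i → i ≢ 0 → 0ℤ ^ i ≡ 0ℤ
0^n≡0 ℕ.zero  i≢0 = contradiction refl i≢0
0^n≡0 (suc i) _   = refl

möbius-≢ : {v u : Graph n} → u ≢ v → möbius v u ≡ 0ℤ
möbius-≢ {n} {v} {u} u≢v = [ below , notBelow ]′ (toSum (v ⊆? u))
  where
  below : v ⊆ u → möbius v u ≡ 0ℤ
  below v⊆u = trans (möbius-sum {v = v} {u} v⊆u)
    (trans (cong (sign (size u) (size v) *_) (0^n≡0 codim λ e → u≢v (sym (codim≡0 e))))
           (ℤ.*-zeroʳ (sign (size u) (size v))))
    where open Interval v u v⊆u
  notBelow : ¬ v ⊆ u → möbius v u ≡ 0ℤ
  notBelow v⊈u = Σ-zero′ (allGraphs n) λ w →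
    trans (ℤ.*-assoc ⟦ v ⊆? w ⟧ ⟦ w ⊆? u ⟧ _) (⟦⟧-*-zero (v ⊆? w) λ v⊆w →
      cong (_* sign (size u) (size w)) (⟦⟧-no (w ⊆? u) λ w⊆u → v⊈u (⊆-trans {g = v} {w} {u} v⊆w w⊆u)))

-- Möbius inversion of N w = Σ[ x ] κ x [ v x ⊆ w ], when only the graphs satisfying B occur as v x.
inversion : (xs : List X) (κ : X → ℤ) (v : X → Graph n) {B : Graph n → Set} (B? : ∀ u → Dec (B u)) →
  (∀ x → κ x * ⟦ B? (v x) ⟧ ≡ κ x) → ∀ h →
  let N = λ w → Σ[ x ← xs ] (κ x * ⟦ v x ⊆? w ⟧) in
  N h ≡ Σ[ u ← allGraphs n ] (⟦ u ⊆? h ⟧ *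
          (⟦ B? u ⟧ * Σ[ w ← allGraphs n ] (⟦ w ⊆? u ⟧ * (sign (size u) (size w) * N w))))
inversion {X} {n} xs κ v B? κB h = sym (begin
  Σ[ u ← gs ] (⟦ u ⊆? h ⟧ * (⟦ B? u ⟧ * Σ[ w ← gs ] (⟦ w ⊆? u ⟧ * (sign (size u) (size w) * N w))))
    ≡⟨ Σ-cong gs (λ u → cong (λ e → ⟦ u ⊆? h ⟧ * (⟦ B? u ⟧ * e)) (inner u)) ⟩
  Σ[ u ← gs ] (⟦ u ⊆? h ⟧ * (⟦ B? u ⟧ * Σ[ x ← xs ] (κ x * möbius (v x) u)))
    ≡⟨ Σ-cong gs (λ u → trans
         (sym (ℤ.*-assoc ⟦ u ⊆? h ⟧ ⟦ B? u ⟧ _))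
         (*-distribˡ-Σ xs (⟦ u ⊆? h ⟧ * ⟦ B? u ⟧) _)) ⟩
  Σ[ u ← gs ] Σ[ x ← xs ] (⟦ u ⊆? h ⟧ * ⟦ B? u ⟧ * (κ x * möbius (v x) u))
    ≡⟨ Σ-comm gs xs _ ⟩
  Σ[ x ← xs ] Σ[ u ← gs ] (⟦ u ⊆? h ⟧ * ⟦ B? u ⟧ * (κ x * möbius (v x) u))
    ≡⟨ Σ-cong xs outer ⟩
  N h ∎)
  where
  gs : List (Graph n)
  gs = allGraphs n
  N : Graph n → ℤ
  N w = Σ[ x ← xs ] (κ x * ⟦ v x ⊆? w ⟧)
  shuffle : ∀ p s k q → p * s * (k * q) ≡ k * (q * p * s)
  shuffle = solve-∀
  inner : ∀ u → Σ[ w ← gs ] (⟦ w ⊆? u ⟧ * (sign (size u) (size w) * N w)) ≡ Σ[ x ← xs ] (κ x * möbius (v x) u)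
  inner u = begin
    Σ[ w ← gs ] (⟦ w ⊆? u ⟧ * (sign (size u) (size w) * N w))
      ≡⟨ Σ-cong gs (λ w → trans (sym (ℤ.*-assoc ⟦ w ⊆? u ⟧ (sign (size u) (size w)) _))
           (*-distribˡ-Σ xs (⟦ w ⊆? u ⟧ * sign (size u) (size w)) _)) ⟩
    Σ[ w ← gs ] Σ[ x ← xs ] (⟦ w ⊆? u ⟧ * sign (size u) (size w) * (κ x * ⟦ v x ⊆? w ⟧))
      ≡⟨ Σ-comm gs xs _ ⟩
    Σ[ x ← xs ] Σ[ w ← gs ] (⟦ w ⊆? u ⟧ * sign (size u) (size w) * (κ x * ⟦ v x ⊆? w ⟧))
      ≡⟨ Σ-cong xs (λ x → trans
           (Σ-cong gs λ w → shuffle ⟦ w ⊆? u ⟧ (sign (size u) (size w)) (κ x) ⟦ v x ⊆? w ⟧)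
           (sym (*-distribˡ-Σ gs (κ x) _))) ⟩
    Σ[ x ← xs ] (κ x * möbius (v x) u) ∎
  reorder : ∀ p q k → p * q * (k * 1ℤ) ≡ k * q * p
  reorder = solve-∀
  outer : ∀ x → Σ[ u ← gs ] (⟦ u ⊆? h ⟧ * ⟦ B? u ⟧ * (κ x * möbius (v x) u)) ≡ κ x * ⟦ v x ⊆? h ⟧
  outer x = begin
    Σ[ u ← gs ] (⟦ u ⊆? h ⟧ * ⟦ B? u ⟧ * (κ x * möbius (v x) u))
      ≡⟨ Σ-graph (v x) (λ u u≢v → trans
           (cong (λ e → ⟦ u ⊆? h ⟧ * ⟦ B? u ⟧ * (κ x * e)) (möbius-≢ {v = v x} {u} u≢v))
           (trans (cong (⟦ u ⊆? h ⟧ * ⟦ B? u ⟧ *_) (ℤ.*-zeroʳ (κ x))) (ℤ.*-zeroʳ (⟦ u ⊆? h ⟧ * ⟦ B? u ⟧)))) ⟩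
    ⟦ v x ⊆? h ⟧ * ⟦ B? (v x) ⟧ * (κ x * möbius (v x) (v x))
      ≡⟨ cong (λ e → ⟦ v x ⊆? h ⟧ * ⟦ B? (v x) ⟧ * (κ x * e)) (möbius-refl (v x)) ⟩
    ⟦ v x ⊆? h ⟧ * ⟦ B? (v x) ⟧ * (κ x * 1ℤ)
      ≡⟨ reorder ⟦ v x ⊆? h ⟧ ⟦ B? (v x) ⟧ (κ x) ⟩
    κ x * ⟦ B? (v x) ⟧ * ⟦ v x ⊆? h ⟧
      ≡⟨ cong (_* ⟦ v x ⊆? h ⟧) (κB x) ⟩
    κ x * ⟦ v x ⊆? h ⟧ ∎

-- Double counting of pairs of a subgraph `s` and a k-set `S` containing its support: for fixed `S`
-- these `s` are the subgraphs of the induced graph. Sets of size `r` give (I), sets of size `k` the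
-- objective.
restrictSum : (h : Graph n) (k : ℕ) (φ : Graph n → ℤ) →
  Σ[ s ← allGraphs n ] (⟦ s ⊆? h ⟧ * (φ s * supersetsOfSize (support s) k)) ≡
  Σ[ S ← allSubsets n ] (⟦ ∣ S ∣ ℕ.≟ k ⟧ * Σ[ s ← allGraphs n ] (⟦ s ⊆? restrict h S ⟧ * φ s))
restrictSum {n} h k φ = begin
  Σ[ s ← gs ] (⟦ s ⊆? h ⟧ * (φ s * supersetsOfSize (support s) k))
    ≡⟨ Σ-cong gs (λ s → trans (sym (ℤ.*-assoc ⟦ s ⊆? h ⟧ (φ s) _)) (*-distribˡ-Σ (allSubsets n) (⟦ s ⊆? h ⟧ * φ s) _)) ⟩
  Σ[ s ← gs ] Σ[ S ← allSubsets n ] (⟦ s ⊆? h ⟧ * φ s * (⟦ support s Subset.⊆? S ⟧ * ⟦ ∣ S ∣ ℕ.≟ k ⟧))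
    ≡⟨ Σ-comm gs (allSubsets n) _ ⟩
  Σ[ S ← allSubsets n ] Σ[ s ← gs ] (⟦ s ⊆? h ⟧ * φ s * (⟦ support s Subset.⊆? S ⟧ * ⟦ ∣ S ∣ ℕ.≟ k ⟧))
    ≡⟨ Σ-cong (allSubsets n) (λ S → trans
         (Σ-cong gs λ s → trans
           (shuffle ⟦ s ⊆? h ⟧ (φ s) ⟦ support s Subset.⊆? S ⟧ ⟦ ∣ S ∣ ℕ.≟ k ⟧)
           (cong (λ e → ⟦ ∣ S ∣ ℕ.≟ k ⟧ * (e * φ s)) (sym (⟦⊆restrict⟧ s h S))))
         (sym (*-distribˡ-Σ gs ⟦ ∣ S ∣ ℕ.≟ k ⟧ _))) ⟩
  Σ[ S ← allSubsets n ] (⟦ ∣ S ∣ ℕ.≟ k ⟧ * Σ[ s ← gs ] (⟦ s ⊆? restrict h S ⟧ * φ s)) ∎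
  where
  gs : List (Graph n)
  gs = allGraphs n
  shuffle : ∀ p f q c → p * f * (q * c) ≡ c * (p * q * f)
  shuffle = solve-∀

-- The subgraph counts of G are feasible

adj-edgeless : ∀ n u v → adj (edgeless n) u v ≡ false
adj-edgeless (suc n) zero    zero    = refl
adj-edgeless (suc n) zero    (suc v) = lookup-replicate v false
adj-edgeless (suc n) (suc u) zero    = lookup-replicate u false
adj-edgeless (suc n) (suc u) (suc v) = adj-edgeless n u v

edgeless-≈ : ∀ a b → edgeless a ≈ edgeless b
edgeless-≈ a b = correspondence⇒≈ record
  { p = 0 ; α = λ () ; β = λ () ; α-injective = λ {i} → λ { {()} } ; β-injective = λ {i} → λ { {()} }
  ; adj-αβ = λ () ; α-covers = isolated a ; β-covers = isolated b }
  where
  isolated : ∀ n {X : Fin 0 → Set} {v} → NonIsolated (edgeless n) v → ∃[ i ] X i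
  isolated n (u , e) = contradiction (trans (sym e) (adj-edgeless n _ u)) λ ()

supersets-support : (s : Graph n) {k : ℕ} → cv s ≤ k →
                    supersetsOfSize (support s) k ≡ pos ((n ℕ.∸ cv s) C (k ℕ.∸ cv s))
supersets-support {n} s {k} le = trans
  (supersetsOfSize-≤ (support s) (subst (_≤ k) (sym (∣support∣ s)) le))
  (cong (λ c → pos ((n ℕ.∸ c) C (k ℕ.∸ c))) (∣support∣ s))

module Counts (𝓔 : Representatives r m) (E⁻¹ : Matrix (suc m)) (inverse : IsInverse (E 𝓔) E⁻¹)
              {n : ℕ} (G : Graph n) where
  open Representatives 𝓔 using (g)

  J : Set
  J = Fin (suc m)
  js : List J
  js = allFin (suc m)
  gs : List (Graph n)
  gs = allGraphs n
  Ss : List (Subset n)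
  Ss = allSubsets n

  z : J → ℤ
  z i = pos (I (g i) G)

  x : J → ℤ
  x j = Σ[ S ← Ss ] (⟦ ∣ S ∣ ℕ.≟ r ⟧ * ⟦ restrict G S ≈? g j ⟧)

  d : J → ℤ
  d h = pos ((n ℕ.∸ cv (g h)) C (r ℕ.∸ cv (g h)))

  z-nonneg : ∀ i → 0ℤ ℤ.≤ z i
  z-nonneg i = ℤ.+≤+ ℕ.z≤n

  x-nonneg : ∀ j → 0ℤ ℤ.≤ x j
  x-nonneg j = Σ-nonneg Ss λ S → subst (0ℤ ℤ.≤_)
    (⟦⟧-× (∣ S ∣ ℕ.≟ r) (restrict G S ≈? g j)) (⟦⟧-nonneg ((∣ S ∣ ℕ.≟ r) ×-dec (restrict G S ≈? g j)))

  edgeless-≈-g₀ : edgeless n ≈ g zero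
  edgeless-≈-g₀ = subst (edgeless n ≈_) (size≡0⇒edgeless (g zero) (Representatives.edgeless 𝓔)) (edgeless-≈ n r)

  z-zero : z zero ≡ 1ℤ
  z-zero = begin
    z zero
      ≡⟨ I-sum (g zero) G ⟩
    Σ[ s ← gs ] (⟦ s ⊆? G ⟧ * ⟦ s ≈? g zero ⟧)
      ≡⟨ Σ-graph (edgeless n) (λ s s≢ → trans
           (cong (⟦ s ⊆? G ⟧ *_) (⟦⟧-no (s ≈? g zero) λ s≈g₀ → s≢ (sym
             (size≡0⇒edgeless s (trans (≈-size s≈g₀) (Representatives.edgeless 𝓔))))))
           (ℤ.*-zeroʳ ⟦ s ⊆? G ⟧)) ⟩
    ⟦ edgeless n ⊆? G ⟧ * ⟦ edgeless n ≈? g zero ⟧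
      ≡⟨ cong₂ _*_ (⟦⟧-yes (edgeless n ⊆? G) (edgeless-⊆ G)) (⟦⟧-yes (edgeless n ≈? g zero) edgeless-≈-g₀) ⟩
    1ℤ ∎

  I-class : (t : Graph n) → cv t ≤ r → ∀ h → Σ[ j ← js ] (E 𝓔 j h * ⟦ t ≈? g j ⟧) ≡ pos (I (g h) t)
  I-class t le h = let (i , t≈gᵢ) = class 𝓔 t le in trans
    (atClass 𝓔 E⁻¹ inverse (λ j → E 𝓔 j h) t t≈gᵢ)
    (cong pos (I-congʳ (g h) (≈-sym t≈gᵢ)))

  -- The diagonal entry is the number of r-sets containing the support of one copy of `g h`, so both
  -- sides count the copies of `g h` in `G` together with an r-set around each.
  Dz≡Eᵀx : ∀ h → d h * z h ≡ Σ[ j ← js ] (x j * E 𝓔 j h)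
  Dz≡Eᵀx h = begin
    d h * z h
      ≡⟨ trans (cong (d h *_) (I-sum (g h) G)) (*-distribˡ-Σ gs (d h) _) ⟩
    Σ[ s ← gs ] (d h * (⟦ s ⊆? G ⟧ * ⟦ s ≈? g h ⟧))
      ≡⟨ Σ-cong gs (λ s → trans (rotate (d h) ⟦ s ⊆? G ⟧ ⟦ s ≈? g h ⟧)
           (cong (⟦ s ⊆? G ⟧ *_) (⟦⟧-*-cong (s ≈? g h) (weight s)))) ⟩
    Σ[ s ← gs ] (⟦ s ⊆? G ⟧ * (⟦ s ≈? g h ⟧ * supersetsOfSize (support s) r))
      ≡⟨ restrictSum G r (λ s → ⟦ s ≈? g h ⟧) ⟩
    Σ[ S ← Ss ] (⟦ ∣ S ∣ ℕ.≟ r ⟧ * Σ[ s ← gs ] (⟦ s ⊆? restrict G S ⟧ * ⟦ s ≈? g h ⟧))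
      -- The bracket supplies `∣ S ∣ ≡ r`, which bounds the non-isolated vertices of the induced
      -- graph and so gives it a class.
      ≡⟨ Σ-cong Ss (λ S → ⟦⟧-*-cong (∣ S ∣ ℕ.≟ r) λ ∣S∣≡r → trans
           (sym (I-sum (g h) (restrict G S)))
           (sym (I-class (restrict G S) (subst (cv (restrict G S) ≤_) ∣S∣≡r (cv-restrict G S)) h))) ⟩
    Σ[ S ← Ss ] (⟦ ∣ S ∣ ℕ.≟ r ⟧ * Σ[ j ← js ] (E 𝓔 j h * ⟦ restrict G S ≈? g j ⟧))
      ≡⟨ Σ-cong Ss (λ S → *-distribˡ-Σ js ⟦ ∣ S ∣ ℕ.≟ r ⟧ _) ⟩
    Σ[ S ← Ss ] Σ[ j ← js ] (⟦ ∣ S ∣ ℕ.≟ r ⟧ * (E 𝓔 j h * ⟦ restrict G S ≈? g j ⟧))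
      ≡⟨ Σ-comm Ss js _ ⟩
    Σ[ j ← js ] Σ[ S ← Ss ] (⟦ ∣ S ∣ ℕ.≟ r ⟧ * (E 𝓔 j h * ⟦ restrict G S ≈? g j ⟧))
      ≡⟨ Σ-cong js (λ j → trans
           (Σ-cong Ss λ S → swap ⟦ ∣ S ∣ ℕ.≟ r ⟧ (E 𝓔 j h) ⟦ restrict G S ≈? g j ⟧)
           (sym (*-distribʳ-Σ Ss (E 𝓔 j h) (λ S → ⟦ ∣ S ∣ ℕ.≟ r ⟧ * ⟦ restrict G S ≈? g j ⟧)))) ⟩
    Σ[ j ← js ] (x j * E 𝓔 j h) ∎
    where
    rotate : ∀ p q s → p * (q * s) ≡ q * (s * p)
    rotate = solve-∀
    swap : ∀ p q s → p * (q * s) ≡ p * s * q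
    swap = solve-∀
    weight : ∀ s → s ≈ g h → d h ≡ supersetsOfSize (support s) r
    weight s s≈gₕ = sym (trans
      (supersets-support s (subst (_≤ r) (sym (≈-cv s≈gₕ)) (cv≤n (g h))))
      (cong (λ c → pos ((n ℕ.∸ c) C (r ℕ.∸ c))) (≈-cv s≈gₕ)))

  D-column : (B : Matrix (suc m)) → ∀ i h → (B · D 𝓔 n) i h ≡ B i h * d h
  D-column B i h = trans (∑≡Σ (suc m) (λ l → B i l * D 𝓔 n l h)) (trans
    (Σ-single (Unique.allFin⁺ (suc m)) (∈-allFin h) λ l l≢h →
      trans (cong (B i l *_) (diag-≢ d l≢h)) (ℤ.*-zeroʳ (B i l)))
    (cong (B i h *_) (diag-≡ d h)))

  -- Once `D z` is replaced by the transpose of `E` applied to `x`, the products `E · E⁻¹` collapse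
  -- and only the negated count of r-sets remains.
  E⁻ᵀDz : ∀ i → ((-ₘ (E⁻¹ ᵀ) · D 𝓔 n) ·ᵥ z) i ≡ - x i
  E⁻ᵀDz i = begin
    ((-ₘ (E⁻¹ ᵀ) · D 𝓔 n) ·ᵥ z) i
      ≡⟨ ∑≡Σ (suc m) (λ h → (-ₘ (E⁻¹ ᵀ) · D 𝓔 n) i h * z h) ⟩
    Σ[ h ← js ] ((-ₘ (E⁻¹ ᵀ) · D 𝓔 n) i h * z h)
      ≡⟨ Σ-cong js (λ h → begin
           (-ₘ (E⁻¹ ᵀ) · D 𝓔 n) i h * z h     ≡⟨ cong (_* z h) (D-column (-ₘ (E⁻¹ ᵀ)) i h) ⟩
           - E⁻¹ h i * d h * z h                ≡⟨ ℤ.*-assoc (- E⁻¹ h i) (d h) (z h) ⟩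
           - E⁻¹ h i * (d h * z h)              ≡⟨ cong (- E⁻¹ h i *_) (Dz≡Eᵀx h) ⟩
           - E⁻¹ h i * Σ[ j ← js ] (x j * E 𝓔 j h)
             ≡⟨ *-distribˡ-Σ js (- E⁻¹ h i) (λ j → x j * E 𝓔 j h) ⟩
           Σ[ j ← js ] (- E⁻¹ h i * (x j * E 𝓔 j h)) ∎) ⟩
    Σ[ h ← js ] Σ[ j ← js ] (- E⁻¹ h i * (x j * E 𝓔 j h))
      ≡⟨ Σ-comm js js (λ h j → - E⁻¹ h i * (x j * E 𝓔 j h)) ⟩
    Σ[ j ← js ] Σ[ h ← js ] (- E⁻¹ h i * (x j * E 𝓔 j h))
      ≡⟨ Σ-cong js (λ j → begin
           Σ[ h ← js ] (- E⁻¹ h i * (x j * E 𝓔 j h))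
             ≡⟨ Σ-cong js (λ h → reorder (E⁻¹ h i) (x j) (E 𝓔 j h)) ⟩
           Σ[ h ← js ] (- x j * (E 𝓔 j h * E⁻¹ h i))
             ≡⟨ sym (*-distribˡ-Σ js (- x j) (λ h → E 𝓔 j h * E⁻¹ h i)) ⟩
           - x j * Σ[ h ← js ] (E 𝓔 j h * E⁻¹ h i)
             ≡⟨ cong (- x j *_) (sym (∑≡Σ (suc m) (λ h → E 𝓔 j h * E⁻¹ h i))) ⟩
           - x j * (E 𝓔 · E⁻¹) j i
             ≡⟨ cong (- x j *_) (proj₁ inverse j i) ⟩
           - x j * 𝟙 j i ∎) ⟩
    Σ[ j ← js ] (- x j * 𝟙 j i)
      ≡⟨ Σ-single (Unique.allFin⁺ (suc m)) (∈-allFin i) (λ j j≢i →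
           trans (cong (- x j *_) (diag-≢ (λ _ → 1ℤ) j≢i)) (ℤ.*-zeroʳ (- x j))) ⟩
    - x i * 𝟙 i i
      ≡⟨ trans (cong (- x i *_) (diag-≡ (λ _ → 1ℤ) i)) (ℤ.*-identityʳ (- x i)) ⟩
    - x i ∎
    where
    reorder : ∀ p q s → - p * (q * s) ≡ - q * (s * p)
    reorder = solve-∀

  z*z : ∀ i j → cv (g i) ℕ.+ cv (g j) ≤ r → z i * z j ≡ Σ[ l ← js ] (c 𝓔 i j l * z l)
  z*z i j small = begin
    z i * z j
      ≡⟨ pairs-count G ⟩
    N G
      -- `N w` counts the pairs whose union lies in `w`; inversion recovers the number of pairs with
      -- union exactly `u`. Cutting off at `cv u ≤ r` loses nothing, since by `small` no union
      -- exceeds that bound, and it provides the vanishing that `classSum` demands.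
      ≡⟨ inversion pairs κ v (λ u → cv u ℕ.≤? r) κ-small G ⟩
    Σ[ u ← gs ] (⟦ u ⊆? G ⟧ * (⟦ cv u ℕ.≤? r ⟧ * Σ[ w ← gs ] (⟦ w ⊆? u ⟧ * (sign (size u) (size w) * N w))))
      ≡⟨ classSum 𝓔 E⁻¹ inverse G φ (c 𝓔 i j) φ≡c φ≡0 ⟩
    Σ[ l ← js ] (c 𝓔 i j l * z l) ∎
    where
    pairs : List (Graph n × Graph n)
    pairs = cartesianProductWith _,_ gs gs
    κ : Graph n × Graph n → ℤ
    κ (s , t) = ⟦ s ≈? g i ⟧ * ⟦ t ≈? g j ⟧
    v : Graph n × Graph n → Graph n
    v (s , t) = union s t
    N φ : Graph n → ℤ
    N w = Σ[ p ← pairs ] (κ p * ⟦ v p ⊆? w ⟧)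
    φ u = ⟦ cv u ℕ.≤? r ⟧ * Σ[ w ← gs ] (⟦ w ⊆? u ⟧ * (sign (size u) (size w) * N w))
    shuffle : ∀ p q s t → p * q * (s * t) ≡ q * t * (p * s)
    shuffle = solve-∀
    pairs-count : ∀ w → pos (I (g i) w) * pos (I (g j) w) ≡ N w
    pairs-count w = begin
      pos (I (g i) w) * pos (I (g j) w)
        ≡⟨ cong₂ _*_ (I-sum (g i) w) (I-sum (g j) w) ⟩
      Σ[ s ← gs ] (⟦ s ⊆? w ⟧ * ⟦ s ≈? g i ⟧) * Σ[ t ← gs ] (⟦ t ⊆? w ⟧ * ⟦ t ≈? g j ⟧)
        ≡⟨ Σ-*-Σ gs gs _ _ ⟩
      Σ[ s ← gs ] Σ[ t ← gs ] (⟦ s ⊆? w ⟧ * ⟦ s ≈? g i ⟧ * (⟦ t ⊆? w ⟧ * ⟦ t ≈? g j ⟧))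
        ≡⟨ Σ-cong gs (λ s → Σ-cong gs λ t → trans
             (shuffle ⟦ s ⊆? w ⟧ ⟦ s ≈? g i ⟧ ⟦ t ⊆? w ⟧ ⟦ t ≈? g j ⟧)
             (cong (κ (s , t) *_) (sym (⟦union⊆⟧ s t w)))) ⟩
      Σ[ s ← gs ] Σ[ t ← gs ] (κ (s , t) * ⟦ union s t ⊆? w ⟧)
        ≡⟨ sym (Σ-cartesianProductWith _,_ gs gs (λ p → κ p * ⟦ v p ⊆? w ⟧)) ⟩
      N w ∎
    κ-small : ∀ p → κ p * ⟦ cv (v p) ℕ.≤? r ⟧ ≡ κ p
    κ-small (s , t) = trans
      (ℤ.*-assoc ⟦ s ≈? g i ⟧ ⟦ t ≈? g j ⟧ _)
      (⟦⟧-*-cong (s ≈? g i) λ s≈gᵢ → trans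
        (⟦⟧-*-cong (t ≈? g j) λ t≈gⱼ → ⟦⟧-yes (cv (union s t) ℕ.≤? r)
          (ℕ.≤-trans (cv-union s t) (subst (_≤ r) (sym (cong₂ ℕ._+_ (≈-cv s≈gᵢ) (≈-cv t≈gⱼ))) small)))
        (ℤ.*-identityʳ _))
    φ≡0 : ∀ u → u ⊆ G → ¬ cv u ≤ r → φ u ≡ 0ℤ
    φ≡0 u _ gt = cong (_* Σ[ w ← gs ] (⟦ w ⊆? u ⟧ * (sign (size u) (size w) * N w)))
                      (⟦⟧-no (cv u ℕ.≤? r) gt)
    reorder : ∀ p q s t → p * (q * s) * t ≡ p * t * q * s
    reorder = solve-∀
    φ≡c : ∀ u l → u ⊆ G → u ≈ g l → φ u ≡ c 𝓔 i j l
    φ≡c u l _ u≈gₗ = begin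
      φ u
        ≡⟨ cong (_* Σ[ w ← gs ] (⟦ w ⊆? u ⟧ * (sign (size u) (size w) * N w))) (⟦⟧-yes (cv u ℕ.≤? r) le) ⟩
      1ℤ * Σ[ w ← gs ] (⟦ w ⊆? u ⟧ * (sign (size u) (size w) * N w))
        ≡⟨ ℤ.*-identityˡ _ ⟩
      Σ[ w ← gs ] (⟦ w ⊆? u ⟧ * (sign (size u) (size w) * N w))
        -- A second regrouping, now of the subgraphs `w` of `u`, produces the sum over `h` that
        -- defines `c`. Each `w` has a class because `cv w ≤ cv u ≤ r`.
        ≡⟨ classSum 𝓔 E⁻¹ inverse u
             (λ w → sign (size u) (size w) * N w)
             (λ h → sign (size u) (size (g h)) * (E 𝓔 h i * E 𝓔 h j))
             (λ w h _ w≈gₕ → cong₂ (λ e x → sign (size u) e * x) (≈-size w≈gₕ) (trans (sym (pairs-count w))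
               (cong₂ (λ a b → pos a * pos b) (I-congʳ (g i) w≈gₕ) (I-congʳ (g j) w≈gₕ))))
             (λ w w⊆u gt → contradiction (ℕ.≤-trans (cv-⊆ {g = w} {u} w⊆u) le) gt) ⟩
      Σ[ h ← js ] (sign (size u) (size (g h)) * (E 𝓔 h i * E 𝓔 h j) * pos (I (g h) u))
        ≡⟨ Σ-cong js (λ h → trans
             (cong₂ (λ e a → sign e (size (g h)) * (E 𝓔 h i * E 𝓔 h j) * pos a) (≈-size u≈gₗ) (I-congʳ (g h) u≈gₗ))
             (reorder (sign (size (g l)) (size (g h))) (E 𝓔 h i) (E 𝓔 h j) (E 𝓔 l h))) ⟩
      Σ[ h ← js ] (sign (size (g l)) (size (g h)) * E 𝓔 l h * E 𝓔 h i * E 𝓔 h j)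
        ≡⟨ sym (∑≡Σ (suc m) (λ h → sign (size (g l)) (size (g h)) * E 𝓔 l h * E 𝓔 h i * E 𝓔 h j)) ⟩
      c 𝓔 i j l ∎
      where
      le : cv u ≤ r
      le = subst (_≤ r) (sym (≈-cv u≈gₗ)) (cv≤n (g l))

  z-feasible : Feasible 𝓔 n E⁻¹ z
  z-feasible = record
    { nonnegative = z-nonneg
    ; normalised = z-zero
    ; constraintI = λ i → subst (ℤ._≤ 0ℤ) (sym (E⁻ᵀDz i)) (ℤ.neg-mono-≤ (x-nonneg i))
    ; constraintII = λ i j small → trans
        (cong (λ e → z i * z j - e) (∑≡Σ (suc m) (λ l → c 𝓔 i j l * z l)))
        (ℤ.i≡j⇒i-j≡0 (z*z i j small))
    }

-- The objective vanishes

[1+n]C2 : ∀ n → suc n C 2 ≡ n C 2 ℕ.+ n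
[1+n]C2 n = trans (sym (nCk+nC[k+1]≡[n+1]C[k+1] n 1))
  (trans (cong (ℕ._+ n C 2) (nC1≡n n)) (ℕ.+-comm n (n C 2)))

size≤ : (g : Graph n) → size g ≤ n C 2
size≤ ∅ = ℕ.z≤n
size≤ {suc n} (g ▸ N) =
  subst (size g ℕ.+ ∣ N ∣ ≤_) (sym ([1+n]C2 n)) (ℕ.+-mono-≤ (size≤ g) (Subset.∣p∣≤n N))

+-tight : ∀ {a b c d} → a ≤ b → c ≤ d → a ℕ.+ c ≡ b ℕ.+ d → a ≡ b × c ≡ d
+-tight {a} {b} {c} {d} a≤b c≤d e = a≡b , ℕ.+-cancelˡ-≡ b c d (trans (cong (ℕ._+ c) (sym a≡b)) e)
  where
  a≡b : a ≡ b
  a≡b = ℕ.≤-antisym a≤b (ℕ.+-cancelʳ-≤ c b a (ℕ.≤-trans (ℕ.+-monoʳ-≤ b c≤d) (ℕ.≤-reflexive (sym e))))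

-- Both summands of the size are bounded, so a maximal total forces each to be maximal: the new
-- vertex is joined to everything and the smaller graph is again maximal.
maximal-size⇒complete : (g : Graph n) → size g ≡ n C 2 → ∀ u v → u ≢ v → Adj g u v
maximal-size⇒complete {suc n} (g ▸ N) e = adjacent
  where
  tight : size g ≡ n C 2 × ∣ N ∣ ≡ n
  tight = +-tight (size≤ g) (Subset.∣p∣≤n N) (trans e ([1+n]C2 n))
  full : ∀ v → lookup N v ≡ true
  full v = trans (cong (λ M → lookup M v) (Subset.∣p∣≡n⇒p≡⊤ {p = N} (proj₂ tight))) (lookup-replicate v true)
  adjacent : ∀ u v → u ≢ v → Adj (g ▸ N) u v
  adjacent zero    zero    u≢v = contradiction refl u≢v
  adjacent zero    (suc v) u≢v = full v
  adjacent (suc u) zero    u≢v = full u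
  adjacent (suc u) (suc v) u≢v = maximal-size⇒complete g (proj₁ tight) u v (u≢v ∘ cong suc)

-- The core has exactly the support as its vertices and the same number of edges as `s`, so it is
-- complete.
support-clique : (s : Graph n) → size s ≡ cv s C 2 → IsClique s (support s)
support-clique s e u v u∈ v∈ u≢v =
  let (i , ιi≡u) = ι-covers s (∈support⇒ s u∈)
      (j , ιj≡v) = ι-covers s (∈support⇒ s v∈)
      i≢j = λ i≡j → u≢v (trans (sym ιi≡u) (trans (cong (ι s) i≡j) ιj≡v))
  in trans (cong₂ (adj s) (sym ιi≡u) (sym ιj≡v)) (trans (sym (adj-core s i j))
       (maximal-size⇒complete (core s) (trans (≈-size (core-≈ s)) e) i j i≢j))

edgeless-restrict : (G : Graph n) (S : Subset n) → size (restrict G S) ≡ 0 → IsIndependent G S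
edgeless-restrict {n} G S e u v u∈ v∈ _ = begin
  adj G u v
    ≡⟨ sym (Bool.∧-identityʳ (adj G u v)) ⟩
  adj G u v ∧ (true ∧ true)
    ≡⟨ cong₂ (λ x y → adj G u v ∧ (x ∧ y)) (sym ([]=⇒lookup u∈)) (sym ([]=⇒lookup v∈)) ⟩
  adj G u v ∧ (lookup S u ∧ lookup S v)
    ≡⟨ sym (adj-restrict G S u v) ⟩
  adj (restrict G S) u v
    ≡⟨ cong (λ h → adj h u v) (sym (size≡0⇒edgeless (restrict G S) e)) ⟩
  adj (edgeless n) u v
    ≡⟨ adj-edgeless n u v ⟩
  false ∎

module Objective (𝓔 : Representatives r m) (E⁻¹ : Matrix (suc m)) (inverse : IsInverse (E 𝓔) E⁻¹)
                 {k : ℕ} (k≤r : k ≤ r) {n : ℕ} (G : Graph n)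
                 (noClique : ¬ (∃[ S ] ∣ S ∣ ≡ k × IsClique G S))
                 (noIndependent : ¬ (∃[ S ] ∣ S ∣ ≡ k × IsIndependent G S)) where
  open Representatives 𝓔 using (g)
  open Counts 𝓔 E⁻¹ inverse G

  term : J → ℤ
  term i = -1ℤ ^ size (g i) * pos ((n ℕ.∸ cv (g i)) C (k ℕ.∸ cv (g i)))

  φ : Graph n → ℤ
  φ s = -1ℤ ^ size s * supersetsOfSize (support s) k

  -- The coefficient `f` without the extra 1 on the class of the complete graph with `k` vertices;
  -- this is the value that `φ` takes on the class.
  ψ : J → ℤ
  ψ i = ⟦ cv (g i) ℕ.≤? k ⟧ * term i

  z-clique : ∀ i → cv (g i) ≡ k → size (g i) ≡ k C 2 → z i ≡ 0ℤ
  z-clique i cv≡k size≡ = trans (I-sum (g i) G) (Σ-zero′ gs λ s → ⟦⟧-*-zero (s ⊆? G) λ s⊆G →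
    ⟦⟧-no (s ≈? g i) λ s≈gᵢ →
      let cvs≡k = trans (≈-cv s≈gᵢ) cv≡k in
      noClique (support s , trans (∣support∣ s) cvs≡k , λ u v u∈ v∈ u≢v →
        s⊆G u v (support-clique s
          (trans (≈-size s≈gᵢ) (trans size≡ (cong (_C 2) (sym cvs≡k)))) u v u∈ v∈ u≢v)))

  -- The two coefficients differ only on the class of the complete graph with `k` vertices, where
  -- `z i` vanishes because `G` has no k-clique.
  f*z : ∀ i → f 𝓔 n k i * z i ≡ ψ i * z i
  f*z i = [ (λ A → cong (_* z i) (trans (if-yes {p = A?} A) (sym (ψ-term A))))
          , (λ ¬A → [ (λ B → trans (*z≡0 (f 𝓔 n k i) B) (sym (*z≡0 (ψ i) B)))
                    , (λ ¬B → cong (_* z i) (trans (if-no {p = A?} ¬A) (trans (if-no {p = B?} ¬B) (sym (ψ-zero ¬A ¬B)))))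
                    ]′ (toSum B?))
          ]′ (toSum A?)
    where
    cvᵢ sizeᵢ : ℕ
    cvᵢ = cv (g i)
    sizeᵢ = size (g i)
    A? : Dec ((cvᵢ ≤ k × sizeᵢ ≢ k C 2) ⊎ cvᵢ ℕ.< k)
    A? = ((cvᵢ ℕ.≤? k) ×-dec ¬? (sizeᵢ ℕ.≟ k C 2)) ⊎-dec (cvᵢ ℕ.<? k)
    B? : Dec (cvᵢ ≡ k × sizeᵢ ≡ k C 2)
    B? = (cvᵢ ℕ.≟ k) ×-dec (sizeᵢ ℕ.≟ k C 2)
    ψ-term : (cvᵢ ≤ k × sizeᵢ ≢ k C 2) ⊎ cvᵢ ℕ.< k → ψ i ≡ term i
    ψ-term A = trans (cong (_* term i) (⟦⟧-yes (cvᵢ ℕ.≤? k) ([ proj₁ , ℕ.<⇒≤ ]′ A))) (ℤ.*-identityˡ (term i))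
    *z≡0 : ∀ y → cvᵢ ≡ k × sizeᵢ ≡ k C 2 → y * z i ≡ 0ℤ
    *z≡0 y (p , q) = trans (cong (y *_) (z-clique i p q)) (ℤ.*-zeroʳ y)
    ψ-zero : ¬ ((cvᵢ ≤ k × sizeᵢ ≢ k C 2) ⊎ cvᵢ ℕ.< k) → ¬ (cvᵢ ≡ k × sizeᵢ ≡ k C 2) → ψ i ≡ 0ℤ
    ψ-zero ¬A ¬B = cong (_* term i) (⟦⟧-no (cvᵢ ℕ.≤? k) λ le → ¬B
      ( ℕ.≤-antisym le (ℕ.≮⇒≥ (¬A ∘ inj₂))
      , decidable-stable (sizeᵢ ℕ.≟ k C 2) λ size≢ → ¬A (inj₁ (le , size≢))))

  φ≡ψ : ∀ s i → s ⊆ G → s ≈ g i → φ s ≡ ψ i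
  φ≡ψ s i _ s≈gᵢ = [ small , large ]′ (toSum (cv (g i) ℕ.≤? k))
    where
    small : cv (g i) ≤ k → φ s ≡ ψ i
    small le = begin
      φ s
        ≡⟨ cong (-1ℤ ^ size s *_) (supersets-support s (subst (_≤ k) (sym (≈-cv s≈gᵢ)) le)) ⟩
      -1ℤ ^ size s * pos ((n ℕ.∸ cv s) C (k ℕ.∸ cv s))
        ≡⟨ cong₂ (λ e c → -1ℤ ^ e * pos ((n ℕ.∸ c) C (k ℕ.∸ c))) (≈-size s≈gᵢ) (≈-cv s≈gᵢ) ⟩
      term i
        ≡⟨ sym (trans (cong (_* term i) (⟦⟧-yes (cv (g i) ℕ.≤? k) le)) (ℤ.*-identityˡ (term i))) ⟩
      ψ i ∎
    large : ¬ cv (g i) ≤ k → φ s ≡ ψ i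
    large gt = begin
      φ s
        ≡⟨ cong (-1ℤ ^ size s *_) (supersetsOfSize-> (support s)
             (λ le → gt (subst (_≤ k) (trans (∣support∣ s) (≈-cv s≈gᵢ)) le))) ⟩
      -1ℤ ^ size s * 0ℤ
        ≡⟨ ℤ.*-zeroʳ (-1ℤ ^ size s) ⟩
      0ℤ
        ≡⟨ sym (cong (_* term i) (⟦⟧-no (cv (g i) ℕ.≤? k) gt)) ⟩
      ψ i ∎

  φ≡0 : ∀ s → s ⊆ G → ¬ cv s ≤ r → φ s ≡ 0ℤ
  φ≡0 s _ gt = trans
    (cong (-1ℤ ^ size s *_) (supersetsOfSize-> (support s)
      (λ le → gt (ℕ.≤-trans (subst (_≤ k) (∣support∣ s) le) k≤r))))
    (ℤ.*-zeroʳ (-1ℤ ^ size s))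

  objective≡0 : objective 𝓔 n k z ≡ 0ℤ
  objective≡0 = begin
    objective 𝓔 n k z
      ≡⟨ ∑≡Σ (suc m) (λ i → f 𝓔 n k i * z i) ⟩
    Σ[ i ← js ] (f 𝓔 n k i * z i)
      ≡⟨ Σ-cong js f*z ⟩
    Σ[ i ← js ] (ψ i * z i)
      ≡⟨ sym (classSum 𝓔 E⁻¹ inverse G φ ψ φ≡ψ φ≡0) ⟩
    Σ[ s ← gs ] (⟦ s ⊆? G ⟧ * φ s)
      ≡⟨ restrictSum G k (λ s → -1ℤ ^ size s) ⟩
    Σ[ S ← Ss ] (⟦ ∣ S ∣ ℕ.≟ k ⟧ * Σ[ s ← gs ] (⟦ s ⊆? restrict G S ⟧ * -1ℤ ^ size s))
      ≡⟨ Σ-zero′ Ss (λ S → ⟦⟧-*-zero (∣ S ∣ ℕ.≟ k) λ ∣S∣≡k → trans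
           (Below.rankSum (restrict G S) -1ℤ)
           (0^n≡0 (size (restrict G S)) λ e → noIndependent (S , ∣S∣≡k , edgeless-restrict G S e))) ⟩
    0ℤ ∎

-- Decidability of the Ramsey property and its least witness

anyClique? : (G : Graph n) (k : ℕ) → Dec (∃[ S ] ∣ S ∣ ≡ k × IsClique G S)
anyClique? G k = Subset.anySubset? λ S → (∣ S ∣ ℕ.≟ k) ×-dec
  Fin.all? λ u → Fin.all? λ v → (u Subset.∈? S) →-dec (v Subset.∈? S) →-dec
    ¬? (u Fin.≟ v) →-dec (adj G u v Bool.≟ true)

anyIndependent? : (G : Graph n) (k : ℕ) → Dec (∃[ S ] ∣ S ∣ ≡ k × IsIndependent G S)
anyIndependent? G k = Subset.anySubset? λ S → (∣ S ∣ ℕ.≟ k) ×-dec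
  Fin.all? λ u → Fin.all? λ v → (u Subset.∈? S) →-dec (v Subset.∈? S) →-dec
    ¬? (u Fin.≟ v) →-dec (adj G u v Bool.≟ false)

ramsey? : ∀ k n → Dec (RamseyProperty k n)
ramsey? k n = map′ (λ all G → All.lookup all (allGraphs-complete G)) (λ R → All.universal R (allGraphs n))
  (All.all? (λ G → anyClique? G k ⊎-dec anyIndependent? G k) (allGraphs n))

-- The conclusion asserts that the Ramsey number exists, so it has to be found: a search upwards
-- from 0, made possible by `ramsey?`, which inspects the finitely many graphs on `n` vertices.
least : {P : ℕ → Set} → (∀ n → Dec (P n)) → ∀ {n} → P n → ∃[ N ] IsLeast _≤_ P N × N ≤ n
least {P} P? {n} Pn = search n 0 (ℕ.+-identityʳ n) λ _ ()
  where
  search : ∀ fuel i → fuel ℕ.+ i ≡ n → (∀ j → j ℕ.< i → ¬ P j) → ∃[ N ] IsLeast _≤_ P N × N ≤ n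
  -- Without fuel the candidate is `n` itself, where `P` holds by assumption.
  search ℕ.zero i refl below = n , (Pn , λ j Pj → ℕ.≮⇒≥ λ j<n → below j j<n Pj) , ℕ.≤-refl
  search (suc fuel) i eq below with P? i
  ... | yes Pi = i , (Pi , λ j Pj → ℕ.≮⇒≥ λ j<i → below j j<i Pj) ,
        subst (i ≤_) eq (ℕ.m≤n+m i (suc fuel))
  ... | no ¬Pi = search fuel (suc i) (trans (ℕ.+-suc fuel i) eq) λ j j<1+i Pj →
        [ (λ j<i → below j j<i Pj) , (λ { refl → ¬Pi Pj }) ]′ (ℕ.m≤n⇒m<n∨m≡n (ℕ.s≤s⁻¹ j<1+i))

minimumPositive⇒ramsey : ∀ {k n} → k ≤ r → (𝓔 : Representatives r m) (E⁻¹ : Matrix (suc m)) →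
  IsInverse (E 𝓔) E⁻¹ → MinimumPositive 𝓔 n E⁻¹ k → RamseyProperty k n
minimumPositive⇒ramsey {k = k} k≤r 𝓔 E⁻¹ inverse (μ , (_ , μ≤) , 0<μ) G =
  [ inj₁ , (λ noClique → inj₂ (decidable-stable (anyIndependent? G k) λ noIndependent →
      let open Counts 𝓔 E⁻¹ inverse G
          open Objective 𝓔 E⁻¹ inverse k≤r G noClique noIndependent
      -- The counts of `G` are a feasible point of value 0, so `μ ≤ 0`.
      in ℤ.<⇒≱ 0<μ (μ≤ 0ℤ (z , z-feasible , sym objective≡0)))) ]′ (toSum (anyClique? G k))

theorem4 : ∀ (k r m : ℕ) → 2 ≤ k → k ≤ r →
    (𝓔 : Representatives r m) →
    (E⁻¹ : Matrix (suc m)) → IsInverse (E 𝓔) E⁻¹ →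
    (∀ n → r ≤ n → MinimumPositive 𝓔 n E⁻¹ k →
    ∃[ N ] IsRamseyNumber k N × N ≤ n)
    × (∀ n → IsLeast _≤_ (λ n′ → r ≤ n′ × MinimumPositive 𝓔 n′ E⁻¹ k) n →
    ∃[ N ] IsRamseyNumber k N × N ≤ n)
theorem4 k r m _ k≤r 𝓔 E⁻¹ inverse = bound , λ n ((r≤n , positive) , _) → bound n r≤n positive
  where
  bound : ∀ n → r ≤ n → MinimumPositive 𝓔 n E⁻¹ k → ∃[ N ] IsRamseyNumber k N × N ≤ n
  bound n _ positive = least (ramsey? k) (minimumPositive⇒ramsey k≤r 𝓔 E⁻¹ inverse positive)
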